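{- Let $D\subseteq\mathbb{Z}^2$ be finite and let $b,a$ be non-negative integers such that $g=f_D-(b-a)$ has no line polynomial factors. Then the set $\mathcal{S}(D,b,a)$ of all $(D,b,a)$-coverings is finite, and one can effectively construct all of its elements.
   Context: Write $X^{\vec u}=x^{u_1}y^{u_2}$ and $f_D=\sum_{\vec u\in D}X^{ -\vec u}$. A line polynomial is a Laurent polynomial in $\mathbb{C}[x^{\pm1},y^{\pm1}]$ whose support has at least two points, all on one line; a line polynomial factor is a divisor that is a line polynomial. A $(D,b,a)$-covering is $c\in\{0,1\}^{\mathbb{Z}^2}$ such that for every $\vec u$, the number of $\vec v\in\vec u+D$ with $c_{\vec v}=1$ is $a$ if $c_{\vec u}=0$ and $b$ if $c_{\vec u}=1$. The set $\mathcal{S}(D,b,a)$ is a subshift of finite type. "Effectively construct" means an algorithm outputs finite descriptions of all elements; in finite subshifts every element is invariant under two linearly independent translations, so it is described by a finite periodic block. -}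

module Defs where

open import Level using (Level; _⊔_)
open import Data.Nat as ℕ using (ℕ; zero; suc)
open import Data.Integer as ℤ using (ℤ; +_; _%ℕ_)
import Data.Integer.Properties as ℤP
open import Data.Bool using (Bool; true; false; if_then_else_)
open import Data.Fin using (Fin; fromℕ<)
open import Data.List using (List; []; _∷_; _++_; foldr; concatMap; map; length)
open import Data.List.Relation.Unary.Any using (Any)
open import Data.List.Relation.Unary.Unique.Propositional using (Unique)
open import Data.Product using (Σ; ∃; _×_; _,_; proj₁; proj₂)
open import Data.Product.Properties using (≡-dec)
open import Relation.Nullary using (¬_; yes; no)
open import Relation.Binary.PropositionalEquality using (_≡_; _≢_)
open import Algebra.Bundles using (CommutativeRing)
open import Data.Integer.DivMod using (n%ℕd<d)
import Data.List.Relation.Unary.All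

ℤ² : Set
ℤ² = ℤ × ℤ

_≟²_ : (u v : ℤ²) → Relation.Nullary.Dec (u ≡ v)
_≟²_ = ≡-dec ℤ._≟_ ℤ._≟_

_+²_ : ℤ² → ℤ² → ℤ²
(a , b) +² (c , d) = (a ℤ.+ c , b ℤ.+ d)

-²_ : ℤ² → ℤ²
-² (a , b) = (ℤ.- a , ℤ.- b)

-- z lies on the line through u and w  (cross product of z-u and w-u vanishes)
Collinear : ℤ² → ℤ² → ℤ² → Set
Collinear (u₁ , u₂) (w₁ , w₂) (z₁ , z₂) =
  (z₁ ℤ.- u₁) ℤ.* (w₂ ℤ.- u₂) ≡ (z₂ ℤ.- u₂) ℤ.* (w₁ ℤ.- u₁)

-- An algebraically closed field of characteristic 0 (the role of ℂ)

module RingOps {c ℓ} (R : CommutativeRing c ℓ) where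
  open CommutativeRing R
  ι : ℕ → Carrier
  ι zero    = 0#
  ι (suc n) = 1# + ι n
  evalU : List Carrier → Carrier → Carrier
  evalU []       t = 0#
  evalU (a ∷ as) t = a + t * evalU as t

record ACField0 (c ℓ : Level) : Set (Level.suc (c ⊔ ℓ)) where
  field
    cring : CommutativeRing c ℓ
  open CommutativeRing cring
  open RingOps cring
  field
    0≉1        : ¬ (0# ≈ 1#)
    inverse    : ∀ x → ¬ (x ≈ 0#) → Σ Carrier λ y → x * y ≈ 1#
    char0      : ∀ n → ¬ (ι (suc n) ≈ 0#)
    algClosed  : ∀ (a : Carrier) (as : List Carrier) →
                 Σ Carrier λ t → evalU (a ∷ as ++ (1# ∷ [])) t ≈ 0#

-- Laurent polynomials in K[x^{±1}, y^{±1}], as finite lists of terms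
-- (coefficient , exponent vector); the term (c , u) stands for c·X^u.

module Laurent {c ℓ} (K : ACField0 c ℓ) where
  open ACField0 K
  open CommutativeRing cring
  open RingOps cring

  LPoly : Set c
  LPoly = List (Carrier × ℤ²)

  coeff : LPoly → ℤ² → Carrier
  coeff []             u = 0#
  coeff ((a , v) ∷ ps) u with v ≟² u
  ... | yes _ = a + coeff ps u
  ... | no  _ = coeff ps u

  _·_ : LPoly → LPoly → LPoly
  p · q = concatMap (λ { (a , u) → map (λ { (b , v) → (a * b , u +² v) }) q }) p

  _≋_ : LPoly → LPoly → Set ℓ
  p ≋ q = ∀ u → coeff p u ≈ coeff q u

  _∣L_ : LPoly → LPoly → Set (c ⊔ ℓ)
  p ∣L g = Σ LPoly λ h → (p · h) ≋ g

  InSupport : LPoly → ℤ² → Set ℓ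
  InSupport p u = ¬ (coeff p u ≈ 0#)

  IsLinePoly : LPoly → Set ℓ
  IsLinePoly p = Σ ℤ² λ u → Σ ℤ² λ w →
    u ≢ w × InSupport p u × InSupport p w ×
    (∀ z → InSupport p z → Collinear u w z)

  HasLinePolyFactor : LPoly → Set (c ⊔ ℓ)
  HasLinePolyFactor g = Σ LPoly λ p → IsLinePoly p × p ∣L g

  fD : List ℤ² → LPoly
  fD D = map (λ u → (1# , -² u)) D

  gPoly : List ℤ² → ℕ → ℕ → LPoly
  gPoly D b a = fD D ++ ((ι a , (+ 0 , + 0)) ∷ (- ι b , (+ 0 , + 0)) ∷ [])

Config : Set
Config = ℤ² → Bool

count : Config → List ℤ² → ℤ² → ℕ
count c []       u = 0
count c (v ∷ vs) u = (if c (u +² v) then 1 else 0) ℕ.+ count c vs u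

IsCovering : List ℤ² → ℕ → ℕ → Config → Set
IsCovering D b a c = ∀ u → count c D u ≡ (if c u then b else a)

-- finite description of a periodic configuration: a period n+1 in both
-- coordinate directions and the (n+1)×(n+1) block it repeats
PeriodicDesc : Set
PeriodicDesc = Σ ℕ λ n → (Fin (suc n) → Fin (suc n) → Bool)

decode : PeriodicDesc → Config
decode (n , blk) (x , y) =
  blk (fromℕ< (n%ℕd<d x (suc n))) (fromℕ< (n%ℕd<d y (suc n)))

-- "S(D,b,a) is finite and effectively constructible": an explicit finite
-- list of periodic descriptions whose decodings are exactly the coverings.

EffectivelyFinite : List ℤ² → ℕ → ℕ → Set
EffectivelyFinite D b a =
  Σ (List PeriodicDesc) λ L →
    Data.List.Relation.Unary.All.All (λ e → IsCovering D b a (decode e)) L ×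
    (∀ (c : Config) → IsCovering D b a c →
       Any (λ e → ∀ u → c u ≡ decode e u) L)

{-# OPTIONS --safe #-}
module Submission where

-- Let X^w act on configurations by translation and let c be a covering, so that g c is
-- constant and e = (X^ε − 1) c is a {−1,0,1}-valued configuration killed by g.
-- * For a prime p exceeding the sum of the |coefficients| of g, Frobenius gives
--   g(X^p) ≡ g^p mod p, so g(X^p) e vanishes mod p and is smaller than p: it is 0.  Hence
--   g(X^n) e = 0 whenever n ≡ 1 mod r, and eliminating all exponents but one v yields
--   ∏_{w ≠ v} (X^{rv} − X^{rw}) e = 0.
-- * Over K each factor X^α − X^β splits as a unit times ∏ (X^d − ω) with d primitive.
--   Modulo X^d − ω, with (d , d′) a basis of ℤ², g becomes a one-variable polynomial in
--   X^{d′}.  It is nonzero because X^d − ω is not a line factor of g, so it splits as a unit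
--   times ∏ (X^{d′} − τ); and X^d = ω, X^{d′} = τ force X^ε = ξ.  Altogether
--   ∏ (X^ε − ξ_j) c = 0 with a number n of factors bounded in terms of g alone.
-- * A 0/1-sequence satisfying a recurrence of order n is determined by any window of length
--   n, so by the pigeonhole principle c has period (2^n)! along ε.
-- With ε the two unit vectors, all coverings repeat a square block of known size, and the
-- finitely many blocks can be tested.

open import Defs
open import Level using (Level; _⊔_)
open import Algebra.Bundles using (CommutativeRing)
open import Algebra.Solver.Ring.AlmostCommutativeRing using (fromCommutativeRing; _-Raw-AlmostCommutative⟶_)
import Algebra.Solver.Ring as RingSolver
open import Data.Bool using (Bool; true; false; if_then_else_)
import Data.Bool.Properties as BoolP
open import Data.Empty using (⊥; ⊥-elim)
open import Data.Fin as Fin using (Fin; toℕ; fromℕ; fromℕ<; inject₁; combine; remQuot; funToFin; finToFun)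
import Data.Fin.Properties as FinP
open import Data.Integer as ℤ using (ℤ; +_; -[1+_]; ∣_∣; _%ℕ_; _/ℕ_)
open import Data.Integer.Divisibility.Signed using (divides; ∣ᵤ⇒∣)
open import Data.Integer.DivMod using (n%ℕd<d; a≡a%ℕn+[a/ℕn]*n)
import Data.Integer.Properties as ℤP
open import Data.Integer.Solver using (module +-*-Solver)
open import Data.List using (List; []; _∷_; _++_; map; concatMap; length; replicate; filter; allFin)
import Data.List.Properties as ListP
open import Data.List.Membership.Propositional using (_∈_; lose)
open import Data.List.Membership.Propositional.Properties using (∈-map⁺; ∈-filter⁺; ∈-allFin)
open import Data.List.Relation.Binary.Pointwise using (Pointwise; []; _∷_)
open import Data.List.Relation.Unary.All as All using (All; []; _∷_; all?)
open import Data.List.Relation.Unary.All.Properties using (map⁺; all-filter; ¬All⇒Any¬)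
open import Data.List.Relation.Unary.Any as Any using (Any; here; there)
open import Data.List.Relation.Unary.Unique.Propositional using (Unique)
open import Data.Maybe using (Maybe; just; nothing)
open import Data.Nat as ℕ using (ℕ; zero; suc; _!)
open import Data.Nat.Combinatorics using (_C_; nCk≡n!/k![n-k]!; k![n∸k]!∣n!; nCn≡1)
open import Data.Nat.Divisibility as ℕD using (_∣_)
open import Data.Nat.DivMod using (m/n*n≡m)
open import Data.Nat.GCD using (gcd; module Bézout; gcd-GCD; gcd[m,n]∣m; gcd[m,n]∣n; gcd[m,n]≡0⇒m≡0; gcd[m,n]≡0⇒n≡0)
open import Data.Nat.ListAction using (product)
open import Data.Nat.ListAction.Properties using (∈⇒∣product)
open import Data.Nat.Primality using (Prime; euclidsLemma; prime⇒nonTrivial; prime⇒nonZero)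
open import Data.Nat.Primality.Factorisation using (PrimeFactorisation; factorise)
import Data.Nat.Properties as ℕP
open import Data.Product using (Σ; _×_; _,_; proj₁; proj₂)
open import Data.Sum using (_⊎_; inj₁; inj₂)
open import Function using (_∘_)
open import Relation.Binary.PropositionalEquality as ≡ using (_≡_; _≢_)
open import Relation.Nullary using (¬_; Dec; yes; no; ¬?)
open import Relation.Nullary.Decidable using (decidable-stable; map′)

-- About g only two things are known: its coefficients are integers, and it has no line polynomial
-- factor. Integrality is used over ℤ, where Frobenius manufactures products of line polynomials
-- that kill e. The missing factors are used over K: X^d - ω does not divide g, so the common kernel
-- of the two is small enough for X^ε to satisfy a one-variable polynomial on it. The map ℤ → K
-- carries e from the first half to the second. The roots τ need not be roots of unity, so the
-- algebra ends in a recurrence and not in a period; only the two-letter alphabet turns it into one.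
-- The order of the recurrence must be bounded before any covering is given, since otherwise the
-- coverings would have no common period and no finite search would follow. The double negation
-- disappears once the claim is an equality of two Booleans, which is decidable.

-- Binomial coefficients modulo a prime

m∣n! : ∀ {m n} → 0 ℕ.< m → m ℕ.≤ n → m ℕD.∣ n !
m∣n! {suc m} _ m≤n = ℕD.∣-trans (ℕD.m∣m*n (m !)) (ℕD.m≤n⇒m!∣n! m≤n)

prime∤! : ∀ {p} → Prime p → ∀ k → k ℕ.< p → ¬ p ∣ k !
prime∤! {p} pr zero k<p p∣ with ℕD.∣1⇒≡1 p∣
... | ≡.refl = ℕP.<-irrefl ≡.refl (ℕ.nonTrivial⇒n>1 1 {{prime⇒nonTrivial pr}})
prime∤! {p} pr (suc k) k<p p∣ with euclidsLemma (suc k) (k !) pr p∣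
... | inj₁ d = ℕP.<⇒≱ k<p (ℕD.∣⇒≤ d)
... | inj₂ d = prime∤! pr k (ℕP.<-trans (ℕP.n<1+n k) k<p) d

-- Since p! = (p C k) · k! · (p - k)!, the prime p divides the right-hand side; both factorials are
-- of numbers below p, so p must divide the binomial coefficient.
prime∣binomial : ∀ {p} → Prime p → ∀ k → 0 ℕ.< k → k ℕ.< p → p ∣ (p C k)
prime∣binomial {zero} pr k 0<k ()
prime∣binomial {p@(suc p′)} pr (suc k′) 0<k k<p = case
  where
  k = suc k′
  instance
    nz : ℕ.NonZero (k ! ℕ.* (p ℕ.∸ k) !)
    nz = k ℕP.!* (p ℕ.∸ k) !≢0
  p∣ : p ∣ (p C k) ℕ.* (k ! ℕ.* (p ℕ.∸ k) !)
  p∣ = ≡.subst (p ∣_)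
         (≡.sym (≡.trans (≡.cong (ℕ._* (k ! ℕ.* (p ℕ.∸ k) !)) (nCk≡n!/k![n-k]! (ℕP.<⇒≤ k<p)))
                         (m/n*n≡m (k![n∸k]!∣n! (ℕP.<⇒≤ k<p)))))
         (ℕD.m∣m*n {p} (p′ !))
  case : p ∣ (p C k)
  case with euclidsLemma (p C k) (k ! ℕ.* (p ℕ.∸ k) !) pr p∣
  ... | inj₁ d = d
  ... | inj₂ d with euclidsLemma (k !) ((p ℕ.∸ k) !) pr d
  ...   | inj₁ e = ⊥-elim (prime∤! pr k k<p e)
  ...   | inj₂ e = ⊥-elim (prime∤! pr (p ℕ.∸ k) (ℕ.s≤s (ℕP.m∸n≤m p′ k′)) e)

-- Integers in a commutative ring, and the Frobenius congruence

module RingFacts {c ℓ} (R : CommutativeRing c ℓ) where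
  open CommutativeRing R hiding (zero)
  open import Algebra.Properties.Ring ring public
    using (-0#≈0#; -‿+-comm; -‿distribˡ-*; -‿distribʳ-*; -‿involutive; x∙y⁻¹≈ε⇒x≈y)
  open import Algebra.Properties.Semiring.Mult semiring public
    using (×-homo-+; ×1-homo-*; ×-assocˡ) renaming (_×_ to _⨉_)
  open import Algebra.Properties.Semiring.Exp semiring public
    using (_^_)
  open import Algebra.Properties.Semiring.Sum semiring using (sum; sum-init-last)
  import Algebra.Properties.CommutativeSemiring.Binomial commutativeSemiring as Binomial
  open import Relation.Binary.Reasoning.Setoid setoid

  -- Serves twice: as the coefficient map of the ring solver in every commutative ring, and later as
  -- the map that carries integer configurations into K.
  ofℤ : ℤ → Carrier
  ofℤ (+ n)    = n ⨉ 1#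
  ofℤ -[1+ n ] = - (suc n ⨉ 1#)

  ofℤ-neg : ∀ z → ofℤ (ℤ.- z) ≈ - ofℤ z
  ofℤ-neg (+ zero)  = sym -0#≈0#
  ofℤ-neg (+ suc n) = refl
  ofℤ-neg -[1+ n ]  = sym (-‿involutive _)

  cancel-1 : ∀ a b → a - b ≈ (1# + a) - (1# + b)
  cancel-1 a b = sym (begin
    (1# + a) - (1# + b)      ≈⟨ +-cong (+-comm 1# a) (sym (-‿+-comm 1# b)) ⟩
    (a + 1#) + (- 1# + - b)  ≈⟨ +-assoc a 1# _ ⟩
    a + (1# + (- 1# + - b))  ≈⟨ +-congˡ (+-assoc 1# (- 1#) (- b)) ⟨
    a + ((1# - 1#) + - b)    ≈⟨ +-congˡ (trans (+-congʳ (-‿inverseʳ 1#)) (+-identityˡ _)) ⟩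
    a - b                    ∎)

  ofℤ-⊖ : ∀ m n → ofℤ (m ℤ.⊖ n) ≈ m ⨉ 1# - n ⨉ 1#
  ofℤ-⊖ m zero = sym (trans (+-congˡ -0#≈0#) (+-identityʳ _))
  ofℤ-⊖ zero (suc n) = sym (+-identityˡ _)
  ofℤ-⊖ (suc m) (suc n) = begin
    ofℤ (suc m ℤ.⊖ suc n)           ≡⟨ ≡.cong ofℤ (ℤP.[1+m]⊖[1+n]≡m⊖n m n) ⟩
    ofℤ (m ℤ.⊖ n)                   ≈⟨ ofℤ-⊖ m n ⟩
    m ⨉ 1# - n ⨉ 1#                 ≈⟨ cancel-1 _ _ ⟩
    suc m ⨉ 1# - suc n ⨉ 1#         ∎

  ofℤ-+ : ∀ x y → ofℤ (x ℤ.+ y) ≈ ofℤ x + ofℤ y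
  ofℤ-+ (+ m) (+ n) = ×-homo-+ 1# m n
  ofℤ-+ (+ m) -[1+ n ] = ofℤ-⊖ m (suc n)
  ofℤ-+ -[1+ m ] (+ n) = trans (ofℤ-⊖ n (suc m)) (+-comm _ _)
  ofℤ-+ -[1+ m ] -[1+ n ] = begin
    - (suc (suc (m ℕ.+ n)) ⨉ 1#)        ≡⟨ ≡.cong (λ k → - (k ⨉ 1#)) (≡.cong suc (≡.sym (ℕP.+-suc m n))) ⟩
    - ((suc m ℕ.+ suc n) ⨉ 1#)          ≈⟨ -‿cong (×-homo-+ 1# (suc m) (suc n)) ⟩
    - (suc m ⨉ 1# + suc n ⨉ 1#)         ≈⟨ -‿+-comm _ _ ⟨
    - (suc m ⨉ 1#) - (suc n ⨉ 1#)       ∎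

  ofℤ-pos* : ∀ m y → ofℤ (+ m ℤ.* y) ≈ m ⨉ 1# * ofℤ y
  ofℤ-pos* m (+ n) = trans (reflexive (≡.cong ofℤ (≡.sym (ℤP.pos-* m n)))) (×1-homo-* m n)
  ofℤ-pos* m -[1+ n ] = begin
    ofℤ (+ m ℤ.* -[1+ n ])        ≡⟨ ≡.cong ofℤ (ℤP.neg-distribʳ-* (+ m) (+ suc n)) ⟨
    ofℤ (ℤ.- (+ m ℤ.* + suc n))   ≈⟨ ofℤ-neg (+ m ℤ.* + suc n) ⟩
    - ofℤ (+ m ℤ.* + suc n)       ≈⟨ -‿cong (ofℤ-pos* m (+ suc n)) ⟩
    - (m ⨉ 1# * (suc n ⨉ 1#))     ≈⟨ -‿distribʳ-* _ _ ⟩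
    m ⨉ 1# * - (suc n ⨉ 1#)       ∎

  ofℤ-* : ∀ x y → ofℤ (x ℤ.* y) ≈ ofℤ x * ofℤ y
  ofℤ-* (+ m) y = ofℤ-pos* m y
  ofℤ-* -[1+ m ] y = begin
    ofℤ (-[1+ m ] ℤ.* y)       ≡⟨ ≡.cong ofℤ (ℤP.neg-distribˡ-* (+ suc m) y) ⟨
    ofℤ (ℤ.- (+ suc m ℤ.* y))  ≈⟨ ofℤ-neg (+ suc m ℤ.* y) ⟩
    - ofℤ (+ suc m ℤ.* y)      ≈⟨ -‿cong (ofℤ-pos* (suc m) y) ⟩
    - (suc m ⨉ 1# * ofℤ y)     ≈⟨ -‿distribˡ-* _ _ ⟩
    - (suc m ⨉ 1#) * ofℤ y     ∎

  ofℤ-morphism : ℤ.+-*-rawRing -Raw-AlmostCommutative⟶ fromCommutativeRing R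
  ofℤ-morphism = record
    { ⟦_⟧ = ofℤ ; +-homo = ofℤ-+ ; *-homo = ofℤ-* ; -‿homo = ofℤ-neg
    ; 0-homo = refl ; 1-homo = +-identityʳ 1# }

  ofℤ-≟ : ∀ x y → Maybe (ofℤ x ≈ ofℤ y)
  ofℤ-≟ x y with x ℤ.≟ y
  ... | yes eq = just (reflexive (≡.cong ofℤ eq))
  ... | no _   = nothing

  module Solver = RingSolver ℤ.+-*-rawRing (fromCommutativeRing R) ofℤ-morphism ofℤ-≟
  open Solver using (solve; _:+_; _:=_)

  ⨉-distrib : ∀ n x y → n ⨉ x + n ⨉ y ≈ n ⨉ (x + y)
  ⨉-distrib zero x y = +-identityˡ _
  ⨉-distrib (suc n) x y = begin
    (x + n ⨉ x) + (y + n ⨉ y) ≈⟨ solve 4 (λ a b c d → (a :+ b) :+ (c :+ d) := (a :+ c) :+ (b :+ d)) refl _ _ _ _ ⟩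
    (x + y) + (n ⨉ x + n ⨉ y) ≈⟨ +-congˡ (⨉-distrib n x y) ⟩
    (x + y) + n ⨉ (x + y)     ∎

  ⨉-zero : ∀ n → n ⨉ 0# ≈ 0#
  ⨉-zero zero = refl
  ⨉-zero (suc n) = trans (+-identityˡ _) (⨉-zero n)

  ⨉-sum : ∀ p n (t : Fin n → Carrier) → (∀ i → Σ Carrier λ h → t i ≈ p ⨉ h) →
          Σ Carrier λ h → sum t ≈ p ⨉ h
  ⨉-sum p zero t f = 0# , sym (⨉-zero p)
  ⨉-sum p (suc n) t f with f Fin.zero | ⨉-sum p n (λ i → t (Fin.suc i)) (λ i → f (Fin.suc i))
  ... | h , e | h′ , e′ = h + h′ , trans (+-cong e e′) (⨉-distrib p h h′)

  -- The outer terms of the binomial expansion are y^p and x^p, and each inner one is a multiple of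
  -- p. The ring is arbitrary because both ℤ (for Fermat) and the ring of Laurent polynomials are
  -- needed.
  frobenius-+ : ∀ {p} → Prime p → ∀ x y → Σ Carrier λ h → (x + y) ^ p ≈ (x ^ p + y ^ p) + p ⨉ h
  frobenius-+ {zero} pr x y = ⊥-elim (ℕ.≢-nonZero⁻¹ 0 {{prime⇒nonZero pr}} ≡.refl)
  frobenius-+ {p@(suc m)} pr x y = proj₁ mid , (begin
    (x + y) ^ p                                      ≈⟨ Binomial.theorem p x y ⟩
    T Fin.zero + sum (λ i → T (Fin.suc i))           ≈⟨ +-congˡ (sum-init-last (λ i → T (Fin.suc i))) ⟩
    T Fin.zero + (sum (λ i → T (Fin.suc (inject₁ i))) + T (fromℕ p)) ≈⟨ +-cong first (+-cong (proj₂ mid) last) ⟩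
    y ^ p + (p ⨉ proj₁ mid + x ^ p)                  ≈⟨ solve 3
      (λ a b c → a :+ (b :+ c) := (c :+ a) :+ b) refl _ _ _ ⟩
    (x ^ p + y ^ p) + p ⨉ proj₁ mid                  ∎)
    where
    T : Fin (suc p) → Carrier
    T = Binomial.binomialTerm x y p
    first : T Fin.zero ≈ y ^ p
    first = trans (+-identityʳ _) (*-identityˡ _)
    last : T (fromℕ p) ≈ x ^ p
    last = begin
      (p C toℕ (fromℕ p)) ⨉ (x ^ toℕ (fromℕ p) * y ^ (p ℕ.∸ toℕ (fromℕ p)))
        ≡⟨ ≡.cong (λ k → (p C k) ⨉ (x ^ k * y ^ (p ℕ.∸ k))) (FinP.toℕ-fromℕ p) ⟩
      (p C p) ⨉ (x ^ p * y ^ (p ℕ.∸ p))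
        ≡⟨ ≡.cong₂ (λ a b → a ⨉ (x ^ p * y ^ b)) (nCn≡1 p) (ℕP.n∸n≡0 p) ⟩
      1 ⨉ (x ^ p * 1#)
        ≈⟨ trans (+-identityʳ _) (*-identityʳ _) ⟩
      x ^ p ∎
    mid : Σ Carrier λ h → sum (λ i → T (Fin.suc (inject₁ i))) ≈ p ⨉ h
    mid = ⨉-sum p m _ λ i → mid-term i
      where
      mid-term : ∀ i → Σ Carrier λ h → T (Fin.suc (inject₁ i)) ≈ p ⨉ h
      mid-term i with prime∣binomial pr (suc (toℕ (inject₁ i))) (ℕ.s≤s ℕ.z≤n)
                       (ℕ.s≤s (≡.subst (ℕ._< m) (≡.sym (FinP.toℕ-inject₁ i)) (FinP.toℕ<n i)))
      ... | ℕD.divides q eq = q ⨉ b , (begin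
        (p C k) ⨉ b     ≡⟨ ≡.cong (_⨉ b) (≡.trans eq (ℕP.*-comm q p)) ⟩
        (p ℕ.* q) ⨉ b   ≈⟨ ×-assocˡ b p q ⟨
        p ⨉ (q ⨉ b)     ∎)
        where
        k = suc (toℕ (inject₁ i))
        b = x ^ k * y ^ (p ℕ.∸ k)

-- Arithmetic of the lattice

0² : ℤ²
0² = + 0 , + 0

infixl 6 _-²_
_-²_ : ℤ² → ℤ² → ℤ²
u -² v = u +² (-² v)

infixr 7 _*²_
_*²_ : ℤ → ℤ² → ℤ²
k *² (x , y) = (k ℤ.* x , k ℤ.* y)

module Z = +-*-Solver

-²-+² : ∀ x u v → x -² (u +² v) ≡ (x -² u) -² v
-²-+² (x , x′) (u , u′) (v , v′) = ≡.cong₂ _,_ (eq x u v) (eq x′ u′ v′)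
  where
  eq : ∀ x u v → x ℤ.- (u ℤ.+ v) ≡ (x ℤ.- u) ℤ.- v
  eq = Z.solve 3 (λ x u v → x Z.:- (u Z.:+ v) Z.:= (x Z.:- u) Z.:- v) ≡.refl

-²-comm : ∀ x u v → (x -² u) -² v ≡ (x -² v) -² u
-²-comm (x , x′) (u , u′) (v , v′) = ≡.cong₂ _,_ (eq x u v) (eq x′ u′ v′)
  where
  eq : ∀ x u v → (x ℤ.- u) ℤ.- v ≡ (x ℤ.- v) ℤ.- u
  eq = Z.solve 3 (λ x u v → (x Z.:- u) Z.:- v Z.:= (x Z.:- v) Z.:- u) ≡.refl

-²-identity : ∀ x → x -² 0² ≡ x
-²-identity (x , x′) = ≡.cong₂ _,_ (ℤP.+-identityʳ x) (ℤP.+-identityʳ x′)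

suc-*² : ∀ n v → + suc n *² v ≡ v +² (+ n *² v)
suc-*² n (x , y) = ≡.cong₂ _,_ (ℤP.suc-* (+ n) x) (ℤP.suc-* (+ n) y)

0-*² : ∀ v → + 0 *² v ≡ 0²
0-*² (x , y) = ≡.refl

*²-assoc : ∀ j k v → j *² (k *² v) ≡ (j ℤ.* k) *² v
*²-assoc j k (x , y) = ≡.cong₂ _,_ (≡.sym (ℤP.*-assoc j k x)) (≡.sym (ℤP.*-assoc j k y))

-- Laurent polynomials acting on configurations

module GroupRing {c ℓ} (R : CommutativeRing c ℓ) where
  open CommutativeRing R hiding (zero)
  open RingFacts R using (module Solver; _^_; _⨉_; -0#≈0#)
  open Solver using (solve; _:+_; _:*_; _:-_; :-_; _:=_; con)
  open import Relation.Binary.Reasoning.Setoid setoid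

  Cfg : Set c
  Cfg = ℤ² → Carrier

  Poly : Set c
  Poly = List (Carrier × ℤ²)

  act : Poly → Cfg → Cfg
  act []            e u = 0#
  act ((a , v) ∷ p) e u = a * e (u -² v) + act p e u

  act-cong : ∀ p {e e′ : Cfg} → (∀ u → e u ≈ e′ u) → ∀ u → act p e u ≈ act p e′ u
  act-cong [] eq u = refl
  act-cong ((a , v) ∷ p) eq u = +-cong (*-congˡ (eq _)) (act-cong p eq u)

  act-++ : ∀ p q e u → act (p ++ q) e u ≈ act p e u + act q e u
  act-++ [] q e u = sym (+-identityˡ _)
  act-++ (t ∷ p) q e u = trans (+-congˡ (act-++ p q e u)) (sym (+-assoc _ _ _))

  mulTerm : Carrier → ℤ² → Carrier × ℤ² → Carrier × ℤ²
  mulTerm a u (b , v) = a * b , u +² v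

  infixl 7 _⊛_
  _⊛_ : Poly → Poly → Poly
  p ⊛ q = concatMap (λ (a , u) → map (mulTerm a u) q) p

  act-mulTerm : ∀ a v q e u → act (map (mulTerm a v) q) e u ≈ a * act q e (u -² v)
  act-mulTerm a v [] e u = sym (zeroʳ a)
  act-mulTerm a v ((b , w) ∷ q) e u = begin
    (a * b) * e (u -² (v +² w)) + act (map (mulTerm a v) q) e u
      ≈⟨ +-cong (*-congˡ (reflexive (≡.cong e (-²-+² u v w)))) (act-mulTerm a v q e u) ⟩
    (a * b) * e ((u -² v) -² w) + a * act q e (u -² v)
      ≈⟨ solve 4 (λ a b x y → (a :* b) :* x :+ a :* y := a :* (b :* x :+ y)) refl _ _ _ _ ⟩
    a * (b * e ((u -² v) -² w) + act q e (u -² v)) ∎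

  act-⊛ : ∀ p q e u → act (p ⊛ q) e u ≈ act p (act q e) u
  act-⊛ [] q e u = refl
  act-⊛ ((a , v) ∷ p) q e u =
    trans (act-++ (map (mulTerm a v) q) (p ⊛ q) e u)
          (+-cong (act-mulTerm a v q e u) (act-⊛ p q e u))

  act-0 : ∀ p u → act p (λ _ → 0#) u ≈ 0#
  act-0 [] u = refl
  act-0 ((a , v) ∷ p) u = trans (+-cong (zeroʳ a) (act-0 p u)) (+-identityˡ 0#)

  act-+ : ∀ p e e′ u → act p (λ x → e x + e′ x) u ≈ act p e u + act p e′ u
  act-+ [] e e′ u = sym (+-identityˡ 0#)
  act-+ ((a , v) ∷ p) e e′ u = trans (+-congˡ (act-+ p e e′ u))
    (solve 5 (λ a b c x y → a :* (b :+ c) :+ (x :+ y) := (a :* b :+ x) :+ (a :* c :+ y)) refl _ _ _ _ _)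

  act-shift : ∀ p a v e u → act p (λ x → a * e (x -² v)) u ≈ a * act p e (u -² v)
  act-shift [] a v e u = sym (zeroʳ a)
  act-shift ((b , w) ∷ p) a v e u = begin
    b * (a * e ((u -² w) -² v)) + act p (λ x → a * e (x -² v)) u
      ≈⟨ +-cong (*-congˡ (*-congˡ (reflexive (≡.cong e (-²-comm u w v))))) (act-shift p a v e u) ⟩
    b * (a * e ((u -² v) -² w)) + a * act p e (u -² v)
      ≈⟨ solve 4 (λ a b x y → b :* (a :* x) :+ a :* y := a :* (b :* x :+ y)) refl _ _ _ _ ⟩
    a * (b * e ((u -² v) -² w) + act p e (u -² v)) ∎

  act-comm : ∀ p q e u → act p (act q e) u ≈ act q (act p e) u
  act-comm [] q e u = sym (act-0 q u)
  act-comm ((a , v) ∷ p) q e u = sym (begin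
    act q (λ x → a * e (x -² v) + act p e x) u               ≈⟨ act-+ q _ _ u ⟩
    act q (λ x → a * e (x -² v)) u + act q (act p e) u       ≈⟨ +-cong (act-shift q a v e u)
      (sym (act-comm p q e u)) ⟩
    a * act q e (u -² v) + act p (act q e) u                 ∎)

  negP : Poly → Poly
  negP = map (λ (a , v) → - a , v)

  act-neg : ∀ p e u → act (negP p) e u ≈ - act p e u
  act-neg [] e u = sym -0#≈0#
  act-neg ((a , v) ∷ p) e u = trans (+-congˡ (act-neg p e u))
    (solve 3 (λ a b c → (:- a) :* b :- c := :- (a :* b :+ c)) refl _ _ _)

  const : Carrier → Poly
  const a = (a , 0²) ∷ []

  act-const : ∀ a e u → act (const a) e u ≈ a * e u
  act-const a e u = trans (+-identityʳ _) (*-congˡ (reflexive (≡.cong e (-²-identity u))))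

  infix 4 _≋_
  record _≋_ (p q : Poly) : Set (c ⊔ ℓ) where
    constructor mk≋
    field app : ∀ e u → act p e u ≈ act q e u
  open _≋_ public

  -- Laurent polynomials are identified when they act alike on all configurations.
  polyRing : CommutativeRing c (c ⊔ ℓ)
  polyRing = record
    { Carrier = Poly ; _≈_ = _≋_ ; _+_ = _++_ ; _*_ = _⊛_ ; -_ = negP ; 0# = [] ; 1# = const 1#
    ; isCommutativeRing = record
      { isRing = record
        { +-isAbelianGroup = record
          { isGroup = record
            { isMonoid = record
              { isSemigroup = record
                { isMagma = record
                  { isEquivalence = record
                    { refl = mk≋ λ e u → refl
                    ; sym = λ f → mk≋ λ e u → sym (app f e u)
                    ; trans = λ f g → mk≋ λ e u → trans (app f e u) (app g e u) }
                  ; ∙-cong = λ {p} {p′} {q} {q′} f g → mk≋ λ e u →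
                      trans (act-++ p q e u) (trans (+-cong (app f e u) (app g e u)) (sym (act-++ p′ q′ e u))) }
                ; assoc = λ p q r → mk≋ λ e u → begin
                    act ((p ++ q) ++ r) e u                  ≈⟨ trans (act-++ (p ++ q) r e u)
                      (+-congʳ (act-++ p q e u)) ⟩
                    (act p e u + act q e u) + act r e u      ≈⟨ +-assoc _ _ _ ⟩
                    act p e u + (act q e u + act r e u)      ≈⟨ trans (act-++ p (q ++ r) e u)
                      (+-congˡ (act-++ q r e u)) ⟨
                    act (p ++ (q ++ r)) e u                  ∎ }
              ; identity = (λ p → mk≋ λ e u → refl)
                         , (λ p → mk≋ λ e u → trans (act-++ p [] e u) (+-identityʳ _)) }
            ; inverse = (λ p → mk≋ λ e u → trans (act-++ (negP p) p e u)
              (trans (+-congʳ (act-neg p e u)) (-‿inverseˡ _)))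
                      , (λ p → mk≋ λ e u → trans (act-++ p (negP p) e u)
                        (trans (+-congˡ (act-neg p e u)) (-‿inverseʳ _)))
            ; ⁻¹-cong = λ {p} {q} f → mk≋ λ e u →
                trans (act-neg p e u) (trans (-‿cong (app f e u)) (sym (act-neg q e u))) }
          ; comm = λ p q → mk≋ λ e u →
              trans (act-++ p q e u) (trans (+-comm _ _) (sym (act-++ q p e u))) }
        ; *-cong = λ {p} {p′} {q} {q′} f g → mk≋ λ e u → begin
            act (p ⊛ q) e u      ≈⟨ act-⊛ p q e u ⟩
            act p (act q e) u    ≈⟨ app f (act q e) u ⟩
            act p′ (act q e) u   ≈⟨ act-cong p′ (app g e) u ⟩
            act p′ (act q′ e) u  ≈⟨ act-⊛ p′ q′ e u ⟨
            act (p′ ⊛ q′) e u    ∎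
        ; *-assoc = λ p q r → mk≋ λ e u → begin
            act ((p ⊛ q) ⊛ r) e u        ≈⟨ trans (act-⊛ (p ⊛ q) r e u) (act-⊛ p q (act r e) u) ⟩
            act p (act q (act r e)) u    ≈⟨ trans (act-⊛ p (q ⊛ r) e u) (act-cong p (act-⊛ q r e) u) ⟨
            act (p ⊛ (q ⊛ r)) e u        ∎
        ; *-identity = (λ p → mk≋ λ e u →
                          trans (act-⊛ (const 1#) p e u) (trans (act-const 1# (act p e) u) (*-identityˡ _)))
                     , (λ p → mk≋ λ e u →
                          trans (act-⊛ p (const 1#) e u)
                                (act-cong p (λ x → trans (act-const 1# e x) (*-identityˡ _)) u))
        ; distrib = (λ p q r → mk≋ λ e u → begin
                      act (p ⊛ (q ++ r)) e u                        ≈⟨ act-⊛ p (q ++ r) e u ⟩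
                      act p (act (q ++ r) e) u                      ≈⟨ act-cong p (act-++ q r e) u ⟩
                      act p (λ x → act q e x + act r e x) u         ≈⟨ act-+ p _ _ u ⟩
                      act p (act q e) u + act p (act r e) u         ≈⟨ +-cong (act-⊛ p q e u) (act-⊛ p r e u) ⟨
                      act (p ⊛ q) e u + act (p ⊛ r) e u             ≈⟨ act-++ (p ⊛ q) (p ⊛ r) e u ⟨
                      act (p ⊛ q ++ p ⊛ r) e u                      ∎)
                  , (λ p q r → mk≋ λ e u → begin
                      act ((q ++ r) ⊛ p) e u                        ≈⟨ act-⊛ (q ++ r) p e u ⟩
                      act (q ++ r) (act p e) u                      ≈⟨ act-++ q r (act p e) u ⟩
                      act q (act p e) u + act r (act p e) u         ≈⟨ +-cong (act-⊛ q p e u) (act-⊛ r p e u) ⟨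
                      act (q ⊛ p) e u + act (r ⊛ p) e u             ≈⟨ act-++ (q ⊛ p) (r ⊛ p) e u ⟨
                      act (q ⊛ p ++ r ⊛ p) e u                      ∎) }
      ; *-comm = λ p q → mk≋ λ e u →
          trans (act-⊛ p q e u) (trans (act-comm p q e u) (sym (act-⊛ q p e u))) } }

  module P = CommutativeRing polyRing
  module PF = RingFacts polyRing

  Kills : Poly → Cfg → Set ℓ
  Kills p e = ∀ u → act p e u ≈ 0#

  Kills-act : ∀ p q {e} → Kills p e → Kills p (act q e)
  Kills-act p q {e} k u = trans (act-comm p q e u) (trans (act-cong q k u) (act-0 q u))

  Kills-⊛ˡ : ∀ p q {e} → Kills p e → Kills (q ⊛ p) e
  Kills-⊛ˡ p q {e} k u = trans (act-⊛ q p e u) (trans (act-cong q k u) (act-0 q u))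

  Kills-⊛ʳ : ∀ p q {e} → Kills p e → Kills (p ⊛ q) e
  Kills-⊛ʳ p q {e} k u = trans (act-⊛ p q e u) (Kills-act p q k u)

  monomial-^ : ∀ z v n → ((z , v) ∷ []) PF.^ n ≋ (z ^ n , + n *² v) ∷ []
  monomial-^ z v zero = mk≋ λ e u → +-congʳ (*-congˡ (reflexive (≡.cong (λ w → e (u -² w)) (≡.sym (0-*² v)))))
  monomial-^ z v (suc n) = P.trans (P.*-congˡ {(z , v) ∷ []} (monomial-^ z v n))
    (mk≋ λ e u → +-congʳ (*-congˡ (reflexive (≡.cong (λ w → e (u -² w)) (≡.sym (suc-*² n v))))))

  act-⨉ : ∀ n p e u → act (n PF.⨉ p) e u ≈ n ⨉ act p e u
  act-⨉ zero p e u = refl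
  act-⨉ (suc n) p e u = trans (act-++ p (n PF.⨉ p) e u) (+-congˡ (act-⨉ n p e u))

  -- This is f(X^n); over ℤ and for prime n it agrees with f^n modulo n.
  dilate : ℕ → Poly → Poly
  dilate n = map (λ (z , v) → z , + n *² v)

  dilate-dilate : ∀ m n f → dilate m (dilate n f) ≡ dilate (m ℕ.* n) f
  dilate-dilate m n [] = ≡.refl
  dilate-dilate m n ((z , v) ∷ f) = ≡.cong₂ _∷_ (≡.cong (z ,_)
    (≡.trans (*²-assoc (+ m) (+ n) v) (≡.cong (_*² v) (≡.sym (ℤP.pos-* m n))))) (dilate-dilate m n f)

  dilate-1 : ∀ f → dilate 1 f ≡ f
  dilate-1 [] = ≡.refl
  dilate-1 ((z , (x , y)) ∷ f) = ≡.cong₂ _∷_ (≡.cong (z ,_) (≡.cong₂ _,_ (ℤP.*-identityˡ x) (ℤP.*-identityˡ y)))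
    (dilate-1 f)

-- Frobenius over ℤ and dilated annihilators

module ZF = RingFacts ℤP.+-*-commutativeRing
module ZG = GroupRing ℤP.+-*-commutativeRing

⨉≡* : ∀ p h → p ZF.⨉ h ≡ + p ℤ.* h
⨉≡* zero h = ≡.refl
⨉≡* (suc p) h = ≡.trans (≡.cong (λ w → h ℤ.+ w) (⨉≡* p h)) (≡.sym (ℤP.suc-* (+ p) h))

1^n≡1 : ∀ n → (+ 1) ZF.^ n ≡ + 1
1^n≡1 zero = ≡.refl
1^n≡1 (suc n) = ≡.trans (ℤP.*-identityˡ _) (1^n≡1 n)

0^p≡0 : ∀ {p} → Prime p → (+ 0) ZF.^ p ≡ + 0
0^p≡0 {zero} pr = ⊥-elim (ℕ.≢-nonZero⁻¹ 0 {{prime⇒nonZero pr}} ≡.refl)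
0^p≡0 {suc p} pr = ℤP.*-zeroˡ ((+ 0) ZF.^ p)

fermat-+ : ∀ {p} → Prime p → ∀ x y → Σ ℤ λ q → (x ℤ.+ y) ZF.^ p ≡ (x ZF.^ p ℤ.+ y ZF.^ p) ℤ.+ + p ℤ.* q
fermat-+ {p} pr x y with ZF.frobenius-+ pr x y
... | h , eq = h , ≡.trans eq (≡.cong (λ w → (x ZF.^ p ℤ.+ y ZF.^ p) ℤ.+ w) (⨉≡* p h))

fermat-pos : ∀ {p} → Prime p → ∀ n → Σ ℤ λ q → (+ n) ZF.^ p ≡ + n ℤ.+ + p ℤ.* q
fermat-pos {p} pr zero = + 0 , ≡.trans (0^p≡0 pr) (≡.sym (≡.trans (ℤP.+-identityˡ _) (ℤP.*-zeroʳ (+ p))))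
fermat-pos {p} pr (suc n) with fermat-pos pr n | fermat-+ pr (+ 1) (+ n)
... | q , eq | h , eq′ = h ℤ.+ q ,
  ≡.trans eq′ (≡.trans (≡.cong (λ w → w ℤ.+ + p ℤ.* h) (≡.cong₂ ℤ._+_ (1^n≡1 p) eq)) (arith h (+ n) (+ p) q))
  where
  arith : ∀ h n p q → (+ 1 ℤ.+ (n ℤ.+ p ℤ.* q)) ℤ.+ p ℤ.* h ≡ (+ 1 ℤ.+ n) ℤ.+ p ℤ.* (h ℤ.+ q)
  arith = Z.solve 4 (λ h n p q → (Z.con (+ 1) Z.:+ (n Z.:+ p Z.:* q)) Z.:+ p Z.:* h Z.:=
    (Z.con (+ 1) Z.:+ n) Z.:+ p Z.:* (h Z.:+ q)) ≡.refl

-- Applying `fermat-+` to n + (-n) = 0 reduces this to the nonnegative case without separating p = 2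
-- from odd p.
fermat-neg : ∀ {p} → Prime p → ∀ n → Σ ℤ λ q → (ℤ.- (+ n)) ZF.^ p ≡ ℤ.- (+ n) ℤ.+ + p ℤ.* q
fermat-neg {p} pr n with fermat-pos pr n | fermat-+ pr (+ n) (ℤ.- (+ n))
... | q , eq | h , eq′ = ℤ.- (h ℤ.+ q) , arith h (+ n) (+ p) q _ _ eq
  (≡.trans (≡.sym eq′) (≡.trans (≡.cong (ZF._^ p) (ℤP.+-inverseʳ (+ n))) (0^p≡0 pr)))
  where
  arith : ∀ h n p q x y → x ≡ n ℤ.+ p ℤ.* q → (x ℤ.+ y) ℤ.+ p ℤ.* h ≡ + 0 →
          y ≡ ℤ.- n ℤ.+ p ℤ.* (ℤ.- (h ℤ.+ q))
  arith h n p q x y ≡.refl eq = ≡.trans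
    (Z.solve 5 (λ h n p q y → y Z.:= ((n Z.:+ p Z.:* q Z.:+ y) Z.:+ p Z.:* h) Z.:+
      (Z.:- n Z.:+ p Z.:* (Z.:- (h Z.:+ q)))) ≡.refl h n p q y)
    (≡.trans (≡.cong (λ w → w ℤ.+ (ℤ.- n ℤ.+ p ℤ.* (ℤ.- (h ℤ.+ q)))) eq) (ℤP.+-identityˡ _))

fermat : ∀ {p} → Prime p → ∀ z → Σ ℤ λ q → z ZF.^ p ≡ z ℤ.+ + p ℤ.* q
fermat pr (+ n) = fermat-pos pr n
fermat pr -[1+ n ] = fermat-neg pr (suc n)

module _ where
  open ZG
  open import Relation.Binary.Reasoning.Setoid P.setoid

  -- Frobenius splits off one term at a time; the power of the term (z , v) is (z^p , pv), and
  -- Fermat replaces z^p by z modulo p.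
  dilate-frobenius : ∀ {p} → Prime p → ∀ f → Σ Poly λ h → f PF.^ p ≋ dilate p f ++ p PF.⨉ h
  dilate-frobenius {zero} pr f = ⊥-elim (ℕ.≢-nonZero⁻¹ 0 {{prime⇒nonZero pr}} ≡.refl)
  dilate-frobenius {p@(suc _)} pr [] = [] , P.sym (PF.⨉-zero p)
  dilate-frobenius {p} pr ((z , v) ∷ f)
    with PF.frobenius-+ pr ((z , v) ∷ []) f | dilate-frobenius pr f | fermat pr z
  ... | h , eq | h′ , eq′ | q , eqz = h ++ (m ++ h′) , (begin
    (t ++ f) PF.^ p                                            ≈⟨ eq ⟩
    (t PF.^ p ++ f PF.^ p) ++ p PF.⨉ h                         ≈⟨ P.+-congʳ (P.+-cong mono eq′) ⟩
    ((t′ ++ p PF.⨉ m) ++ (dilate p f ++ p PF.⨉ h′)) ++ p PF.⨉ h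
      ≈⟨ solve 5 (λ a b c d e → ((a :+ b) :+ (c :+ d)) :+ e := (a :+ c) :+ (e :+ (b :+ d))) P.refl t′ (p PF.⨉ m)
        (dilate p f) (p PF.⨉ h′) (p PF.⨉ h) ⟩
    (t′ ++ dilate p f) ++ (p PF.⨉ h ++ (p PF.⨉ m ++ p PF.⨉ h′))
      ≈⟨ P.+-congˡ {t′ ++ dilate p f}
        (P.trans (P.+-congˡ {p PF.⨉ h} (PF.⨉-distrib p m h′)) (PF.⨉-distrib p h (m ++ h′))) ⟩
    dilate p ((z , v) ∷ f) ++ p PF.⨉ (h ++ (m ++ h′)) ∎)
    where
    open PF.Solver using (solve; _:+_; _:=_)
    t = (z , v) ∷ []
    t′ = (z , + p *² v) ∷ []
    m = (q , + p *² v) ∷ []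
    arith : ∀ z p q x → (z ℤ.+ p ℤ.* q) ℤ.* x ℤ.+ + 0 ≡ z ℤ.* x ℤ.+ p ℤ.* (q ℤ.* x ℤ.+ + 0)
    arith = Z.solve 4 (λ z p q x → (z Z.:+ p Z.:* q) Z.:* x Z.:+ Z.con (+ 0) Z.:= z Z.:* x Z.:+ p Z.:*
      (q Z.:* x Z.:+ Z.con (+ 0))) ≡.refl
    mono : t PF.^ p ≋ t′ ++ p PF.⨉ m
    mono = P.trans (monomial-^ z v p) (mk≋ λ e u → let x = e (u -² (+ p *² v)) in
      ≡.trans (≡.cong (λ w → w ℤ.* x ℤ.+ + 0) eqz)
      (≡.trans (arith z (+ p) q x)
        (≡.cong (λ w → z ℤ.* x ℤ.+ w) (≡.trans (≡.sym (⨉≡* p _)) (≡.sym (act-⨉ p m e u))))))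

  norm : Poly → ℕ
  norm [] = 0
  norm ((z , v) ∷ f) = ∣ z ∣ ℕ.+ norm f

  norm-dilate : ∀ n f → norm (dilate n f) ≡ norm f
  norm-dilate n [] = ≡.refl
  norm-dilate n ((z , v) ∷ f) = ≡.cong (∣ z ∣ ℕ.+_) (norm-dilate n f)

  act-bound : ∀ f {e : Cfg} → (∀ u → ∣ e u ∣ ℕ.≤ 1) → ∀ u → ∣ act f e u ∣ ℕ.≤ norm f
  act-bound [] bd u = ℕ.z≤n
  act-bound ((z , v) ∷ f) {e} bd u = ℕP.≤-trans (ℤP.∣i+j∣≤∣i∣+∣j∣ (z ℤ.* e (u -² v)) _)
    (ℕP.+-mono-≤ (≡.subst₂ ℕ._≤_ (≡.sym (ℤP.abs-* z (e (u -² v)))) (ℕP.*-identityʳ _)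
      (ℕP.*-monoʳ-≤ ∣ z ∣ (bd (u -² v))))
                 (act-bound f bd u))

  dilate-prime-kills : ∀ {p} → Prime p → ∀ f {e : Cfg} → norm f ℕ.< p → (∀ u → ∣ e u ∣ ℕ.≤ 1) →
                       Kills f e → Kills (dilate p f) e
  dilate-prime-kills {zero} pr f ()
  dilate-prime-kills {p@(suc m)} pr f {e} f<p bd k u with dilate-frobenius pr f
  ... | h , eq = ℤP.∣i∣≡0⇒i≡0 (small x∣
        (ℕP.≤-<-trans (≡.subst (∣ act (dilate p f) e u ∣ ℕ.≤_) (norm-dilate p f) (act-bound (dilate p f) bd u)) f<p))
    where
    y = act h e u
    x = act (dilate p f) e u
    sum0 : x ℤ.+ + p ℤ.* y ≡ + 0
    sum0 = ≡.trans (≡.cong (λ w → x ℤ.+ w) (≡.trans (≡.sym (⨉≡* p y)) (≡.sym (act-⨉ p h e u))))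
             (≡.trans (≡.sym (act-++ (dilate p f) (p PF.⨉ h) e u))
               (≡.trans (≡.sym (app eq e u)) (Kills-⊛ʳ f (f PF.^ m) k u)))
    x≡ : x ≡ + p ℤ.* (ℤ.- y)
    x≡ = ≡.trans (Z.solve 3 (λ x p y → x Z.:= (x Z.:+ p Z.:* y) Z.:+ p Z.:* (Z.:- y)) ≡.refl x (+ p) y)
           (≡.trans (≡.cong (λ w → w ℤ.+ + p ℤ.* (ℤ.- y)) sum0) (ℤP.+-identityˡ _))
    x∣ : p ∣ ∣ x ∣
    x∣ = ℕD.divides ∣ ℤ.- y ∣ (≡.trans (≡.cong ∣_∣ x≡) (≡.trans (ℤP.abs-* (+ p) (ℤ.- y)) (ℕP.*-comm p _)))
    small : ∀ {n} → p ∣ n → n ℕ.< p → n ≡ 0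
    small {zero} _ _ = ≡.refl
    small {suc n} d n<p = ⊥-elim (ℕP.<⇒≱ n<p (ℕD.∣⇒≤ d))

  -- The primes are applied one after another: each acts on the polynomial already dilated by the
  -- others, whose norm is still that of f.
  dilate-product-kills : ∀ f {e : Cfg} → (∀ u → ∣ e u ∣ ℕ.≤ 1) → Kills f e →
    ∀ ps → All Prime ps → All (norm f ℕ.<_) ps → Kills (dilate (product ps) f) e
  dilate-product-kills f bd k [] _ _ = ≡.subst (λ g → Kills g _) (≡.sym (dilate-1 f)) k
  dilate-product-kills f bd k (p ∷ ps) (pr ∷ prs) (b ∷ bs) =
    ≡.subst (λ g → Kills g _) (dilate-dilate p (product ps) f)
      (dilate-prime-kills pr (dilate (product ps) f) (≡.subst (ℕ._< p) (≡.sym (norm-dilate (product ps) f)) b) bd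
        (dilate-product-kills f bd k ps prs bs))

  -- A prime factor p ≤ `norm f` of 1 + k · (norm f)! would divide (norm f)! and hence 1. So all
  -- prime factors are large enough for the Frobenius argument.
  dilate-kills : ∀ f {e : Cfg} → (∀ u → ∣ e u ∣ ℕ.≤ 1) → Kills f e →
    ∀ k → Kills (dilate (suc (k ℕ.* norm f !)) f) e
  dilate-kills f bd kf k =
    ≡.subst (λ n → Kills (dilate n f) _) (≡.sym isFactorisation)
      (dilate-product-kills f bd kf factors factorsPrime (All.tabulate large))
    where
    n = suc (k ℕ.* norm f !)
    open PrimeFactorisation (factorise n)
    large : ∀ {p} → p ∈ factors → norm f ℕ.< p
    large {p} p∈ with p ℕ.≤? norm f
    ... | no  p≰ = ℕP.≰⇒> p≰
    ... | yes p≤ = ⊥-elim (contra (ℕD.∣1⇒≡1 (ℕD.∣m+n∣m⇒∣n p∣n′ p∣k)))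
      where
      pr : Prime p
      pr = All.lookup factorsPrime p∈
      p>1 : 1 ℕ.< p
      p>1 = ℕ.nonTrivial⇒n>1 p {{prime⇒nonTrivial pr}}
      contra : p ≡ 1 → ⊥
      contra eq = ℕP.<-irrefl (≡.sym eq) p>1
      p∣n : p ∣ n
      p∣n = ≡.subst (p ∣_) (≡.sym isFactorisation) (∈⇒∣product p∈)
      p∣n′ : p ∣ k ℕ.* norm f ! ℕ.+ 1
      p∣n′ = ≡.subst (p ∣_) (ℕP.+-comm 1 _) p∣n
      p∣k : p ∣ k ℕ.* norm f !
      p∣k = ℕD.∣n⇒∣m*n k (m∣n! (ℕP.<-trans (ℕ.s≤s ℕ.z≤n) p>1) p≤)

-- Isolating one exponent by products of differences

module Differences {c ℓ} (R : CommutativeRing c ℓ) where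
  open CommutativeRing R hiding (zero)

  -- The action of ∏ (X^α − X^β) over the pairs (α , β) in the list.
  diffs : List (ℤ² × ℤ²) → (ℤ² → Carrier) → ℤ² → Carrier
  diffs []            e u = e u
  diffs ((α , β) ∷ V) e u = diffs V e (u -² α) - diffs V e (u -² β)

pairs : ℕ → ℤ² → List ℤ² → List (ℤ² × ℤ²)
pairs r v = map (λ w → + r *² v , + r *² w)

-²-step : ∀ r k u v → (u -² (+ suc (k ℕ.* r) *² v)) -² (+ r *² v) ≡ u -² (+ suc (suc k ℕ.* r) *² v)
-²-step r k (x , y) (v , w) = ≡.cong₂ _,_ (eq x v) (eq y w)
  where
  arith : ∀ a b x v → (x ℤ.- a ℤ.* v) ℤ.- b ℤ.* v ≡ x ℤ.- (a ℤ.+ b) ℤ.* v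
  arith = Z.solve 4 (λ a b x v → (x Z.:- a Z.:* v) Z.:- b Z.:* v Z.:= x Z.:- (a Z.:+ b) Z.:* v) ≡.refl
  coe : + suc (k ℕ.* r) ℤ.+ + r ≡ + suc (suc k ℕ.* r)
  coe = ≡.cong (λ n → + suc n) (ℕP.+-comm (k ℕ.* r) r)
  eq : ∀ x v → (x ℤ.- + suc (k ℕ.* r) ℤ.* v) ℤ.- + r ℤ.* v ≡ x ℤ.- + suc (suc k ℕ.* r) ℤ.* v
  eq x v = ≡.trans (arith (+ suc (k ℕ.* r)) (+ r) x v) (≡.cong (λ n → x ℤ.- n ℤ.* v) coe)

*²-cancel : ∀ r .{{_ : ℕ.NonZero r}} u v → + r *² u ≡ + r *² v → u ≡ v
*²-cancel r@(suc _) (x , y) (x′ , y′) eq =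
  ≡.cong₂ _,_ (ℤP.*-cancelˡ-≡ (+ r) x x′ (≡.cong proj₁ eq)) (ℤP.*-cancelˡ-≡ (+ r) y y′ (≡.cong proj₂ eq))

coefℤ : ZG.Poly → ℤ² → ℤ
coefℤ []            u = + 0
coefℤ ((z , v) ∷ p) u with v ≟² u
... | yes _ = z ℤ.+ coefℤ p u
... | no  _ = coefℤ p u

module Isolation (r : ℕ) (e : ℤ² → ℤ) where
  open ZG
  open Differences ℤP.+-*-commutativeRing

  -- With Y_v = X^{rv}, the relations Σ z_v X^v Y_v^k e = 0 for all k combine to
  -- Σ z_v X^v Q(Y_v) e = 0 for every polynomial Q with coefficients independent of v;
  -- here Q(Y) = Y^k ∏_{w ∈ W} (Y − X^{rw}).
  wsum : List ℤ² → ℕ → Poly → ℤ² → ℤ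
  wsum W k []            u = + 0
  wsum W k ((z , v) ∷ f) u = z ℤ.* diffs (pairs r v W) e (u -² (+ suc (k ℕ.* r) *² v)) ℤ.+ wsum W k f u

  wsum-[] : ∀ k f u → wsum [] k f u ≡ act (dilate (suc (k ℕ.* r)) f) e u
  wsum-[] k [] u = ≡.refl
  wsum-[] k ((z , v) ∷ f) u = ≡.cong (λ y → z ℤ.* e (u -² (+ suc (k ℕ.* r) *² v)) ℤ.+ y) (wsum-[] k f u)

  -- Multiplying Q(Y_v) by Y_v - X^{rw}: the factor Y_v raises k by one, and X^{rw} does not depend
  -- on v, so it leaves the sum as a translation.
  wsum-∷ : ∀ w W k f u → wsum (w ∷ W) k f u ≡ wsum W (suc k) f u ℤ.- wsum W k f (u -² (+ r *² w))
  wsum-∷ w W k [] u = ≡.refl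
  wsum-∷ w W k ((z , v) ∷ f) u = ≡.trans
    (≡.cong₂ (λ a b → z ℤ.* a ℤ.+ b)
      (≡.cong₂ ℤ._-_ (≡.cong F (-²-step r k u v)) (≡.cong F (-²-comm u _ _)))
      (wsum-∷ w W k f u))
    (arith z _ _ _ _)
    where
    F : ℤ² → ℤ
    F = diffs (pairs r v W) e
    arith : ∀ z a b c d → z ℤ.* (a ℤ.- b) ℤ.+ (c ℤ.- d) ≡ (z ℤ.* a ℤ.+ c) ℤ.- (z ℤ.* b ℤ.+ d)
    arith = Z.solve 5 (λ z a b c d → z Z.:* (a Z.:- b) Z.:+ (c Z.:- d) Z.:= (z Z.:* a Z.:+ c) Z.:-
      (z Z.:* b Z.:+ d)) ≡.refl

  wsum≡0 : ∀ f → (∀ k → Kills (dilate (suc (k ℕ.* r)) f) e) → ∀ W k u → wsum W k f u ≡ + 0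
  wsum≡0 f kf [] k u = ≡.trans (wsum-[] k f u) (kf k u)
  wsum≡0 f kf (w ∷ W) k u = ≡.trans (wsum-∷ w W k f u) (≡.cong₂ ℤ._-_ (wsum≡0 f kf W (suc k) u) (wsum≡0 f kf W k _))

  -- One of the factors is X^{rv} - X^{rv}.
  diffs-∈ : ∀ {v W} → v ∈ W → ∀ u → diffs (pairs r v W) e u ≡ + 0
  diffs-∈ {v} {_ ∷ W} (here ≡.refl) u = ℤP.+-inverseʳ (diffs (pairs r v W) e (u -² (+ r *² v)))
  diffs-∈ (there v∈W) u = ≡.cong₂ ℤ._-_ (diffs-∈ v∈W _) (diffs-∈ v∈W _)

  -- This is Lagrange interpolation: Q has the root X^{rw} for every exponent w other than v₀, so
  -- only terms with exponent v₀ survive. The list f may repeat v₀, and these terms add up to the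
  -- coefficient.
  wsum-isolate : ∀ v₀ W f → (∀ {v} → v ∈ map proj₂ f → v ≢ v₀ → v ∈ W) → ∀ u →
    wsum W 0 f u ≡ coefℤ f v₀ ℤ.* diffs (pairs r v₀ W) e (u -² (+ 1 *² v₀))
  wsum-isolate v₀ W [] h u = ≡.sym (ℤP.*-zeroˡ (diffs (pairs r v₀ W) e (u -² (+ 1 *² v₀))))
  wsum-isolate v₀ W ((z , v) ∷ f) h u with v ≟² v₀
  ... | yes ≡.refl = ≡.trans (≡.cong (λ y → z ℤ.* X ℤ.+ y) (wsum-isolate v₀ W f (λ m → h (there m)) u))
                             (≡.sym (ℤP.*-distribʳ-+ X z (coefℤ f v₀)))
    where X = diffs (pairs r v₀ W) e (u -² (+ 1 *² v₀))
  ... | no v≢ = ≡.trans (≡.cong₂ (λ x y → z ℤ.* x ℤ.+ y) (diffs-∈ (h (here ≡.refl) v≢) _)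
        (wsum-isolate v₀ W f (λ m → h (there m)) u))
                        (≡.trans (≡.cong (λ x → x ℤ.+ coefℤ f v₀ ℤ.* X) (ℤP.*-zeroʳ z)) (ℤP.+-identityˡ _))
    where X = diffs (pairs r v₀ W) e (u -² (+ 1 *² v₀))

module _ where
  open ZG
  open Differences ℤP.+-*-commutativeRing

  +²-cancel : ∀ u v → (u +² v) -² v ≡ u
  +²-cancel (x , y) (v , w) = ≡.cong₂ _,_ (eq x v) (eq y w)
    where
    eq : ∀ x v → (x ℤ.+ v) ℤ.- v ≡ x
    eq = Z.solve 2 (λ x v → (x Z.:+ v) Z.:- v Z.:= x) ≡.refl

  differenceAnnihilator : ∀ f v₀ → coefℤ f v₀ ≢ + 0 →
    Σ (List (ℤ² × ℤ²)) λ V → All (λ (α , β) → α ≢ β) V ×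
      (∀ e → (∀ u → ∣ e u ∣ ℕ.≤ 1) → Kills f e → ∀ u → diffs V e u ≡ + 0)
  differenceAnnihilator f v₀ c≢0 = pairs r v₀ W , distinct , kills
    where
    r : ℕ
    r = norm f !
    P? = λ w → ¬? (w ≟² v₀)
    W : List ℤ²
    W = filter P? (map proj₂ f)
    distinct : All (λ (α , β) → α ≢ β) (pairs r v₀ W)
    distinct = map⁺ (All.map (λ w≢ eq → w≢ (≡.sym (*²-cancel r {{norm f ℕP.!≢0}} _ _ eq)))
      (all-filter P? (map proj₂ f)))
    kills : ∀ e → (∀ u → ∣ e u ∣ ℕ.≤ 1) → Kills f e → ∀ u → diffs (pairs r v₀ W) e u ≡ + 0
    kills e bd kf u with ℤP.i*j≡0⇒i≡0∨j≡0 (coefℤ f v₀) prod≡0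
      where
      -- The isolated term still carries X^{v₀}; evaluating at u + v₀ undoes that translation. The 1
      -- is the exponent 1 + kr at k = 0.
      u′ = u +² (+ 1 *² v₀)
      open Isolation r e using (wsum-isolate; wsum≡0)
      prod≡0 : coefℤ f v₀ ℤ.* diffs (pairs r v₀ W) e (u′ -² (+ 1 *² v₀)) ≡ + 0
      prod≡0 = ≡.trans (≡.sym (wsum-isolate v₀ W f (λ m v≢ → ∈-filter⁺ P? m v≢) u′))
        (wsum≡0 f (dilate-kills f bd kf) W 0 u′)
    ... | inj₁ eq = ⊥-elim (c≢0 eq)
    ... | inj₂ eq = ≡.trans (≡.cong (diffs (pairs r v₀ W) e) (≡.sym (+²-cancel u _))) eq

-- Primitive vectors and bases of ℤ²

det : ℤ² → ℤ² → ℤ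
det (a , b) (c , d) = a ℤ.* d ℤ.- b ℤ.* c

abs-multiple : ∀ p → Σ ℤ λ s → + ∣ p ∣ ≡ s ℤ.* p
abs-multiple (+ n)    = + 1 , ≡.sym (ℤP.*-identityˡ (+ n))
abs-multiple -[1+ n ] = -[1+ 0 ] , ≡.sym (ℤP.-1*i≡-i -[1+ n ])

bézout : ∀ p q → Σ ℤ λ α → Σ ℤ λ β → α ℤ.* p ℤ.+ β ℤ.* q ≡ + gcd ∣ p ∣ ∣ q ∣
bézout p q with abs-multiple p | abs-multiple q | Bézout.identity (gcd-GCD ∣ p ∣ ∣ q ∣)
... | s , eqs | t , eqt | Bézout.+- x y eq = + x ℤ.* s , ℤ.- (+ y ℤ.* t) ,
  solve (+ x) (+ y) s t p q (≡.trans (≡.sym (cast _ y ∣ q ∣)) (≡.trans (≡.cong +_ eq) (ℤP.pos-* x ∣ p ∣))) eqs eqt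
  where
  cast : ∀ g y n → + (g ℕ.+ y ℕ.* n) ≡ + g ℤ.+ + y ℤ.* + n
  cast g y n = ≡.cong (λ z → + g ℤ.+ z) (ℤP.pos-* y n)
  solve : ∀ x y s t p q {g P Q} → g ℤ.+ y ℤ.* Q ≡ x ℤ.* P → P ≡ s ℤ.* p → Q ≡ t ℤ.* q →
          x ℤ.* s ℤ.* p ℤ.+ ℤ.- (y ℤ.* t) ℤ.* q ≡ g
  solve x y s t p q {g} eq ≡.refl ≡.refl = ≡.trans
    (Z.solve 6 (λ x y s t p q → x Z.:* s Z.:* p Z.:+ Z.:- (y Z.:* t) Z.:* q Z.:= x Z.:* (s Z.:* p) Z.:- y Z.:*
      (t Z.:* q)) ≡.refl x y s t p q)
    (≡.trans (≡.cong (λ z → z ℤ.- y ℤ.* (t ℤ.* q)) (≡.sym eq))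
      (Z.solve 2 (λ g z → (g Z.:+ z) Z.:- z Z.:= g) ≡.refl g (y ℤ.* (t ℤ.* q))))
... | s , eqs | t , eqt | Bézout.-+ x y eq = ℤ.- (+ x ℤ.* s) , + y ℤ.* t ,
  solve (+ x) (+ y) s t p q (≡.trans (≡.sym (cast _ x ∣ p ∣)) (≡.trans (≡.cong +_ eq) (ℤP.pos-* y ∣ q ∣))) eqs eqt
  where
  cast : ∀ g y n → + (g ℕ.+ y ℕ.* n) ≡ + g ℤ.+ + y ℤ.* + n
  cast g y n = ≡.cong (λ z → + g ℤ.+ z) (ℤP.pos-* y n)
  solve : ∀ x y s t p q {g P Q} → g ℤ.+ x ℤ.* P ≡ y ℤ.* Q → P ≡ s ℤ.* p → Q ≡ t ℤ.* q →
          ℤ.- (x ℤ.* s) ℤ.* p ℤ.+ y ℤ.* t ℤ.* q ≡ g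
  solve x y s t p q {g} eq ≡.refl ≡.refl = ≡.trans
    (Z.solve 6 (λ x y s t p q → Z.:- (x Z.:* s) Z.:* p Z.:+ y Z.:* t Z.:* q Z.:= y Z.:* (t Z.:* q) Z.:- x Z.:*
      (s Z.:* p)) ≡.refl x y s t p q)
    (≡.trans (≡.cong (λ z → z ℤ.- x ℤ.* (s ℤ.* p)) (≡.sym eq))
      (Z.solve 2 (λ g z → (g Z.:+ z) Z.:- z Z.:= g) ≡.refl g (x ℤ.* (s ℤ.* p))))

-- Determinant 1 makes (d , d′) a basis of ℤ², so d is primitive, and `suc index` is the gcd of the
-- coordinates of v.
record PrimitiveBasis (v : ℤ²) : Set where
  field
    index        : ℕ
    d d′         : ℤ²
    unimodular   : det d d′ ≡ + 1
    multiple     : v ≡ + suc index *² d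

abstract
  -- With αp + βq = g the gcd, take d = (p/g , q/g) and d′ = (-β , α); their determinant is (αp +
  -- βq)/g.
  primitiveBasis : ∀ v → v ≢ 0² → PrimitiveBasis v
  primitiveBasis v@(p , q) v≢0 = go (gcd ∣ p ∣ ∣ q ∣) ≡.refl
    where
    go : ∀ g → gcd ∣ p ∣ ∣ q ∣ ≡ g → PrimitiveBasis v
    go zero eq = ⊥-elim (v≢0 (≡.cong₂ _,_
      (ℤP.∣i∣≡0⇒i≡0 (gcd[m,n]≡0⇒m≡0 eq)) (ℤP.∣i∣≡0⇒i≡0 (gcd[m,n]≡0⇒n≡0 ∣ p ∣ eq))))
    go (suc m) eq with bézout p q | ∣ᵤ⇒∣ {+ gcd ∣ p ∣ ∣ q ∣} {p}
      (gcd[m,n]∣m ∣ p ∣ ∣ q ∣) | ∣ᵤ⇒∣ {+ gcd ∣ p ∣ ∣ q ∣} {q} (gcd[m,n]∣n ∣ p ∣ ∣ q ∣)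
    ... | α , β , bz | divides p′ eqp | divides q′ eqq rewrite eq = record
      { index = m ; d = p′ , q′ ; d′ = ℤ.- β , α
      ; unimodular = ℤP.*-cancelˡ-≡ (+ suc m) _ _ (solve α β p q (+ suc m) p′ q′ bz eqp eqq)
      ; multiple = ≡.cong₂ _,_ (≡.trans eqp (ℤP.*-comm p′ (+ suc m))) (≡.trans eqq (ℤP.*-comm q′ (+ suc m))) }
      where
      solve : ∀ α β p q g p′ q′ → α ℤ.* p ℤ.+ β ℤ.* q ≡ g → p ≡ p′ ℤ.* g → q ≡ q′ ℤ.* g →
              g ℤ.* (p′ ℤ.* α ℤ.- q′ ℤ.* (ℤ.- β)) ≡ g ℤ.* + 1
      solve α β _ _ g p′ q′ eq ≡.refl ≡.refl = ≡.trans
        (Z.solve 5 (λ α β g p q → g Z.:* (p Z.:* α Z.:- q Z.:* (Z.:- β)) Z.:= α Z.:* (p Z.:* g) Z.:+ β Z.:*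
          (q Z.:* g)) ≡.refl α β g p′ q′)
        (≡.trans eq (≡.sym (ℤP.*-identityʳ g)))

-- Cramer's rule with determinant 1.
basis-coordinates : ∀ d d′ → det d d′ ≡ + 1 → ∀ u → u ≡ (det u d′ *² d) +² (det d u *² d′)
basis-coordinates (a , b) (a′ , b′) eq (x , y) = ≡.cong₂ _,_ (first a b a′ b′ x y eq) (second a b a′ b′ x y eq)
  where
  first : ∀ a b a′ b′ x y → a ℤ.* b′ ℤ.- b ℤ.* a′ ≡ + 1 →
          x ≡ (x ℤ.* b′ ℤ.- y ℤ.* a′) ℤ.* a ℤ.+ (a ℤ.* y ℤ.- b ℤ.* x) ℤ.* a′
  first a b a′ b′ x y eq = ≡.trans (≡.sym (ℤP.*-identityˡ x)) (≡.trans (≡.cong (ℤ._* x) (≡.sym eq))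
    (Z.solve 6 (λ a b a′ b′ x y → (a Z.:* b′ Z.:- b Z.:* a′) Z.:* x Z.:= (x Z.:* b′ Z.:- y Z.:* a′) Z.:* a Z.:+
      (a Z.:* y Z.:- b Z.:* x) Z.:* a′) ≡.refl a b a′ b′ x y))
  second : ∀ a b a′ b′ x y → a ℤ.* b′ ℤ.- b ℤ.* a′ ≡ + 1 →
           y ≡ (x ℤ.* b′ ℤ.- y ℤ.* a′) ℤ.* b ℤ.+ (a ℤ.* y ℤ.- b ℤ.* x) ℤ.* b′
  second a b a′ b′ x y eq = ≡.trans (≡.sym (ℤP.*-identityˡ y)) (≡.trans (≡.cong (ℤ._* y) (≡.sym eq))
    (Z.solve 6 (λ a b a′ b′ x y → (a Z.:* b′ Z.:- b Z.:* a′) Z.:* y Z.:= (x Z.:* b′ Z.:- y Z.:* a′) Z.:* b Z.:+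
      (a Z.:* y Z.:- b Z.:* x) Z.:* b′) ≡.refl a b a′ b′ x y))

-- Permits case distinctions on equality in K wherever the goal is itself doubly negated.
¬¬-lem : ∀ {a} {A : Set a} → ¬ ¬ (A ⊎ ¬ A)
¬¬-lem k = k (inj₂ λ a → k (inj₁ a))

+²-identityˡ : ∀ u → 0² +² u ≡ u
+²-identityˡ (x , y) = ≡.cong₂ _,_ (ℤP.+-identityˡ x) (ℤP.+-identityˡ y)

+²-assoc : ∀ u v w → (u +² v) +² w ≡ u +² (v +² w)
+²-assoc (x , y) (x′ , y′) (x″ , y″) = ≡.cong₂ _,_ (ℤP.+-assoc x x′ x″) (ℤP.+-assoc y y′ y″)

+²-inverseˡ : ∀ u → (-² u) +² u ≡ 0²
+²-inverseˡ (x , y) = ≡.cong₂ _,_ (ℤP.+-inverseˡ x) (ℤP.+-inverseˡ y)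

-²-neg : ∀ u v → u -² (-² v) ≡ u +² v
-²-neg u (x , y) = ≡.cong (u +²_) (≡.cong₂ _,_ (ℤP.neg-involutive x) (ℤP.neg-involutive y))

neg-*² : ∀ k v → (ℤ.- k) *² v ≡ -² (k *² v)
neg-*² k (x , y) = ≡.cong₂ _,_ (≡.sym (ℤP.neg-distribˡ-* k x)) (≡.sym (ℤP.neg-distribˡ-* k y))

-²-split : ∀ u α β → u -² (α -² β) ≡ (u +² β) -² α
-²-split (x , y) (a , b) (a′ , b′) = ≡.cong₂ _,_ (eq x a a′) (eq y b b′)
  where
  eq : ∀ x a a′ → x ℤ.- (a ℤ.- a′) ≡ (x ℤ.+ a′) ℤ.- a
  eq = Z.solve 3 (λ x a a′ → x Z.:- (a Z.:- a′) Z.:= (x Z.:+ a′) Z.:- a) ≡.refl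

-²≡0⇒≡ : ∀ α β → α -² β ≡ 0² → α ≡ β
-²≡0⇒≡ (a , b) (a′ , b′) eq = ≡.cong₂ _,_ (ℤP.i-j≡0⇒i≡j a a′ (≡.cong proj₁ eq)) (ℤP.i-j≡0⇒i≡j b b′ (≡.cong proj₂ eq))

abstract
  -- Multiplication by a monomial in X^d and X^{d′}, which is a unit, clears the negative
  -- coordinates of u. This is how a Laurent monomial becomes an ordinary one in these two
  -- variables.
  cone-shift : ∀ d d′ → det d d′ ≡ + 1 → ∀ u → Σ ℕ λ i → Σ ℕ λ j → Σ ℕ λ σ → Σ ℕ λ κ →
    ((+ i *² d) +² (+ j *² d′)) +² u ≡ (+ σ *² d) +² (+ κ *² d′)
  cone-shift d d′ eq u with nonneg (det u d′) | nonneg (det d u)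
    where
    nonneg : ∀ z → Σ ℕ λ i → Σ ℕ λ σ → + i ℤ.+ z ≡ + σ
    nonneg (+ n)    = 0 , n , ℤP.+-identityˡ (+ n)
    nonneg -[1+ n ] = suc n , 0 , ℤP.+-inverseʳ (+ suc n)
  ... | i , σ , eqσ | j , κ , eqκ = i , j , σ , κ ,
    ≡.trans (≡.cong (λ w → ((+ i *² d) +² (+ j *² d′)) +² w) (basis-coordinates d d′ eq u))
            (merge d d′ (+ i) (+ j) (det u d′) (det d u) eqσ eqκ)
    where
    merge : ∀ d d′ i j s k {σ κ} → i ℤ.+ s ≡ σ → j ℤ.+ k ≡ κ →
      ((i *² d) +² (j *² d′)) +² ((s *² d) +² (k *² d′)) ≡ (σ *² d) +² (κ *² d′)
    merge (a , b) (a′ , b′) i j s k ≡.refl ≡.refl = ≡.cong₂ _,_ (arith i j s k a a′) (arith i j s k b b′)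
      where
      arith : ∀ i j s k a b → (i ℤ.* a ℤ.+ j ℤ.* b) ℤ.+ (s ℤ.* a ℤ.+ k ℤ.* b) ≡ (i ℤ.+ s) ℤ.* a ℤ.+ (j ℤ.+ k) ℤ.* b
      arith = Z.solve 6 (λ i j s k a b → (i Z.:* a Z.:+ j Z.:* b) Z.:+ (s Z.:* a Z.:+ k Z.:* b) Z.:=
        (i Z.:+ s) Z.:* a Z.:+ (j Z.:+ k) Z.:* b) ≡.refl

-- Coefficients and eigenconfigurations over K

module OverField {c ℓ} (K : ACField0 c ℓ) where
  open ACField0 K
  open CommutativeRing cring hiding (zero)
  open RingOps cring
  module F = RingFacts cring
  open GroupRing cring public
  open Differences cring public
  module L = Laurent K
  open F.Solver using (solve; _:+_; _:*_; _:-_; :-_; _:=_; con)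
  open import Relation.Binary.Reasoning.Setoid setoid

  δ : Cfg
  δ x with x ≟² 0²
  ... | yes _ = 1#
  ... | no  _ = 0#

  δ-0 : ∀ x → x ≡ 0² → δ x ≈ 1#
  δ-0 x eq with x ≟² 0²
  ... | yes _ = refl
  ... | no ne = ⊥-elim (ne eq)

  δ-≢ : ∀ x → x ≢ 0² → δ x ≈ 0#
  δ-≢ x ne with x ≟² 0²
  ... | yes eq = ⊥-elim (ne eq)
  ... | no _   = refl

  -- A polynomial acting on the delta configuration displays its coefficients. Hence an identity
  -- between actions yields the coefficientwise identity by which divisibility is defined.
  coeff-act : ∀ p u → L.coeff p u ≈ act p δ u
  coeff-act [] u = refl
  coeff-act ((a , v) ∷ p) u with v ≟² u
  ... | yes eq = +-cong (sym (trans
        (*-congˡ (δ-0 (u -² v) (≡.trans (≡.cong (_-² v) (≡.sym eq)) (+²-inverseʳ v)))) (*-identityʳ a)))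
          (coeff-act p u)
    where
    +²-inverseʳ : ∀ u → u -² u ≡ 0²
    +²-inverseʳ (x , y) = ≡.cong₂ _,_ (ℤP.+-inverseʳ x) (ℤP.+-inverseʳ y)
  ... | no ne = sym (trans (+-cong (trans (*-congˡ (δ-≢ (u -² v) λ eq → ne (≡.sym (-²≡0⇒≡ u v eq)))) (zeroʳ a))
        (sym (coeff-act p u))) (+-identityˡ _))

  act-· : ∀ p q e u → act (p L.· q) e u ≈ act p (act q e) u
  act-· [] q e u = refl
  act-· ((a , v) ∷ p) q e u = trans (act-++ (map _ q) (p L.· q) e u) (+-cong (term q) (act-· p q e u))
    where
    term : ∀ q → act (map (λ { (b , w) → (a * b , v +² w) }) q) e u ≈ a * act q e (u -² v)
    term q = act-mulTerm a v q e u

  ∣L-intro : ∀ p h g → p ⊛ h ≋ g → p L.∣L g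
  ∣L-intro p h g eq = h , λ u → begin
    L.coeff (p L.· h) u  ≈⟨ coeff-act (p L.· h) u ⟩
    act (p L.· h) δ u    ≈⟨ trans (act-· p h δ u) (sym (act-⊛ p h δ u)) ⟩
    act (p ⊛ h) δ u      ≈⟨ app eq δ u ⟩
    act g δ u            ≈⟨ coeff-act g u ⟨
    L.coeff g u          ∎

  mon : ℤ² → Poly
  mon v = (1# , v) ∷ []

  lin : ℤ² → Carrier → Poly
  lin v a = (1# , v) ∷ (- a , 0²) ∷ []

  coeff-hit : ∀ a v p u → v ≡ u → L.coeff ((a , v) ∷ p) u ≈ a + L.coeff p u
  coeff-hit a v p u eq with v ≟² u
  ... | yes _ = refl
  ... | no ne = ⊥-elim (ne eq)

  coeff-miss : ∀ a v p u → v ≢ u → L.coeff ((a , v) ∷ p) u ≈ L.coeff p u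
  coeff-miss a v p u ne with v ≟² u
  ... | yes eq = ⊥-elim (ne eq)
  ... | no _   = refl

  lin-isLine : ∀ d a → d ≢ 0² → ¬ a ≈ 0# → L.IsLinePoly (lin d a)
  lin-isLine d a d≢0 a≉0 = 0² , d , (λ eq → d≢0 (≡.sym eq)) , at-0 , at-d , λ z → collinear z
    where
    const′ : Poly
    const′ = const (- a)
    at-0 : L.InSupport (lin d a) 0²
    at-0 eq = a≉0 (begin
      a              ≈⟨ solve 1 (λ a → a := :- (:- a :+ con (+ 0))) refl a ⟩
      - (- a + 0#)   ≈⟨ -‿cong (trans
        (sym (trans (coeff-miss 1# d const′ 0² d≢0) (coeff-hit (- a) 0² [] 0² ≡.refl))) eq) ⟩
      - 0#           ≈⟨ F.-0#≈0# ⟩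
      0#             ∎)
    at-d : L.InSupport (lin d a) d
    at-d eq = 0≉1 (begin
      0#                        ≈⟨ eq ⟨
      L.coeff (lin d a) d       ≈⟨ trans (coeff-hit 1# d const′ d ≡.refl)
        (+-congˡ (coeff-miss (- a) 0² [] d λ e → d≢0 (≡.sym e))) ⟩
      1# + 0#                   ≈⟨ +-identityʳ 1# ⟩
      1#                        ∎)
    arith : ∀ x y → (x ℤ.- + 0) ℤ.* (y ℤ.- + 0) ≡ (y ℤ.- + 0) ℤ.* (x ℤ.- + 0)
    arith x y = ℤP.*-comm (x ℤ.- + 0) (y ℤ.- + 0)
    collinear : ∀ z → L.InSupport (lin d a) z → Collinear 0² d z
    collinear z nz with d ≟² z
    ... | yes ≡.refl = arith (proj₁ d) (proj₂ d)
    ... | no d≢z = on-0 (0² ≟² z)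
      where
      on-0 : Dec (0² ≡ z) → Collinear 0² d z
      on-0 (yes ≡.refl) = ≡.trans (ℤP.*-zeroˡ (proj₂ d ℤ.- + 0)) (≡.sym (ℤP.*-zeroˡ (proj₁ d ℤ.- + 0)))
      on-0 (no 0≢z) = ⊥-elim (nz (coeff-miss (- a) 0² [] z 0≢z))

  Eigen : ℤ² → Carrier → Cfg → Set ℓ
  Eigen v a e = ∀ u → e (u -² v) ≈ a * e u

  act-lin : ∀ v a e u → act (lin v a) e u ≈ e (u -² v) - a * e u
  act-lin v a e u = trans
    (+-cong (*-identityˡ _) (+-congʳ (*-congˡ (reflexive (≡.cong e (-²-identity u))))))
    (solve 3 (λ a x y → x :+ (:- a :* y :+ con (+ 0)) := x :- a :* y) refl a _ _)

  lin⇒eigen : ∀ {v a e} → Kills (lin v a) e → Eigen v a e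
  lin⇒eigen {v} {a} {e} k u = F.x∙y⁻¹≈ε⇒x≈y _ _ (trans (sym (act-lin v a e u)) (k u))

  eigen⇒lin : ∀ {v a e} → Eigen v a e → Kills (lin v a) e
  eigen⇒lin {v} {a} {e} k u = trans (act-lin v a e u) (trans (+-congʳ (k u)) (-‿inverseʳ _))

  eigen-+ : ∀ {v w a b e} → Eigen v a e → Eigen w b e → Eigen (v +² w) (a * b) e
  eigen-+ {v} {w} {a} {b} {e} ev ew u = begin
    e (u -² (v +² w))     ≡⟨ ≡.cong e (-²-+² u v w) ⟩
    e ((u -² v) -² w)     ≈⟨ ew (u -² v) ⟩
    b * e (u -² v)        ≈⟨ *-congˡ (ev u) ⟩
    b * (a * e u)         ≈⟨ solve 3 (λ a b x → b :* (a :* x) := (a :* b) :* x) refl a b (e u) ⟩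
    (a * b) * e u         ∎

  eigen-neg : ∀ {v a b e} → a * b ≈ 1# → Eigen v a e → Eigen (-² v) b e
  eigen-neg {v} {a} {b} {e} ab ev u = begin
    e (u -² (-² v))                ≡⟨ ≡.cong e (-²-neg u v) ⟩
    e (u +² v)                     ≈⟨ trans (*-congʳ ab) (*-identityˡ _) ⟨
    (a * b) * e (u +² v)           ≈⟨ solve 3 (λ a b x → (a :* b) :* x := b :* (a :* x)) refl a b _ ⟩
    b * (a * e (u +² v))           ≈⟨ *-congˡ (ev (u +² v)) ⟨
    b * e ((u +² v) -² v)          ≡⟨ ≡.cong (λ w → b * e w) (+²-cancel u v) ⟩
    b * e u                        ∎

  -- The eigenvalue b is chosen before e, because the same ξ has to serve all configurations at
  -- once.
  eigen-ℕ* : ∀ v a n → Σ Carrier λ b → ∀ e → Eigen v a e → Eigen (+ n *² v) b e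
  eigen-ℕ* v a zero = 1# , λ e ev u →
    trans (reflexive (≡.cong e (≡.trans (≡.cong (λ w → u -² w) (0-*² v)) (-²-identity u)))) (sym (*-identityˡ _))
  eigen-ℕ* v a (suc n) with eigen-ℕ* v a n
  ... | b , h = a * b , λ e ev → ≡.subst (λ w → Eigen w (a * b) e) (≡.sym (suc-*² n v)) (eigen-+ ev (h e ev))

  eigen-ℤ* : ∀ v a → ¬ a ≈ 0# → ∀ k → Σ Carrier λ b → ∀ e → Eigen v a e → Eigen (k *² v) b e
  eigen-ℤ* v a a≉0 (+ n) = eigen-ℕ* v a n
  eigen-ℤ* v a a≉0 -[1+ n ] with inverse a a≉0
  ... | a⁻¹ , eq with eigen-ℕ* (-² v) a⁻¹ (suc n)
  ...   | b , h = b , λ e ev → ≡.subst (λ w → Eigen w b e) (neg-neg v) (h e (eigen-neg eq ev))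
    where
    neg-neg : ∀ v → + suc n *² (-² v) ≡ -[1+ n ] *² v
    neg-neg (x , y) = ≡.cong₂ _,_ (arith x) (arith y)
      where
      arith : ∀ x → + suc n ℤ.* (ℤ.- x) ≡ -[1+ n ] ℤ.* x
      arith x = ≡.trans (≡.sym (ℤP.neg-distribʳ-* (+ suc n) x)) (ℤP.neg-distribˡ-* (+ suc n) x)

  -- Translations are invertible, so the eigenvalue 0 belongs only to the zero configuration.
  eigen-0 : ∀ {v a e} → a ≈ 0# → Eigen v a e → ∀ u → e u ≈ 0#
  eigen-0 {v} {a} {e} a≈0 ev u = begin
    e u                ≡⟨ ≡.cong e (+²-cancel u v) ⟨
    e ((u +² v) -² v)  ≈⟨ ev (u +² v) ⟩
    a * e (u +² v)     ≈⟨ trans (*-congʳ a≈0) (zeroˡ _) ⟩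
    0#                 ∎

-- Splitting into linear factors, and congruences

module Splitting {c ℓ} (K : ACField0 c ℓ) where
  open ACField0 K
  open CommutativeRing cring hiding (zero)
  open RingOps cring
  open OverField K
  open PF.Solver using (solve; _:+_; _:*_; _:-_; :-_; _:=_; con)
  open import Relation.Binary.Reasoning.Setoid P.setoid

  const-+ : ∀ a b → const (a + b) ≋ const a ++ const b
  const-+ a b = mk≋ λ e u → trans (+-identityʳ _) (trans (distribʳ _ a b) (+-congˡ (sym (+-identityʳ _))))

  const-0 : const 0# ≋ []
  const-0 = mk≋ λ e u → trans (+-identityʳ _) (zeroˡ _)

  const-cong : ∀ {a b} → a ≈ b → const a ≋ const b
  const-cong eq = mk≋ λ e u → +-congʳ (*-congʳ eq)

  univ : Poly → List Carrier → Poly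
  univ s []       = []
  univ s (a ∷ as) = const a ++ s ⊛ univ s as

  monic : List Carrier → List Carrier
  monic as = as ++ 1# ∷ []

  linProd : ℤ² → List Carrier → Poly
  linProd v []       = const 1#
  linProd v (t ∷ ts) = lin v t ⊛ linProd v ts

  -- Synthetic division: for any a these are the non-leading coefficients of the quotient of the
  -- monic polynomial `monic (a ∷ as)` by s - t. The constant term a affects only the remainder.
  hornerQuotient : Carrier → List Carrier → List Carrier
  hornerQuotient t []       = []
  hornerQuotient t (a ∷ as) = evalU (monic (a ∷ as)) t ∷ hornerQuotient t as

  hornerQuotient-length : ∀ t as → length (hornerQuotient t as) ≡ length as
  hornerQuotient-length t []       = ≡.refl
  hornerQuotient-length t (a ∷ as) = ≡.cong suc (hornerQuotient-length t as)

  divide-linear : ∀ t s a as → univ s (monic (a ∷ as)) ≋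
    const (evalU (monic (a ∷ as)) t) ++ (s ++ negP (const t)) ⊛ univ s (monic (hornerQuotient t as))
  divide-linear t s a [] = begin
    const a ++ s ⊛ (const 1# ++ s ⊛ [])
      ≈⟨ solve 4 (λ a s t o → a :+ s :* (o :+ s :* con (+ 0)) := (a :+ t :* o) :+ (s :- t) :*
        (o :+ s :* con (+ 0))) P.refl (const a) s (const t) (const 1#) ⟩
    (const a ++ const t ⊛ const 1#) ++ (s ++ negP (const t)) ⊛ (const 1# ++ s ⊛ [])
      ≈⟨ P.+-congʳ {(s ++ negP (const t)) ⊛ (const 1# ++ s ⊛ [])} const-value ⟨
    const (a + t * (1# + t * 0#)) ++ (s ++ negP (const t)) ⊛ (const 1# ++ s ⊛ []) ∎
    where
    const-value : const (a + t * (1# + t * 0#)) ≋ const a ++ const t ⊛ const 1#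
    const-value = P.trans (const-cong (+-congˡ (*-congˡ (trans (+-congˡ (zeroʳ t)) (+-identityʳ 1#)))))
      (const-+ a (t * 1#))
  divide-linear t s a (b ∷ as) = begin
    const a ++ s ⊛ univ s (monic (b ∷ as))
      ≈⟨ P.+-congˡ {const a} (P.*-congˡ {s} (divide-linear t s b as)) ⟩
    const a ++ s ⊛ (const E ++ (s ++ negP (const t)) ⊛ q)
      ≈⟨ solve 5 (λ a s e t q → a :+ s :* (e :+ (s :- t) :* q) := (a :+ t :* e) :+ (s :- t) :* (e :+ s :* q))
        P.refl (const a) s (const E) (const t) q ⟩
    (const a ++ const t ⊛ const E) ++ (s ++ negP (const t)) ⊛ (const E ++ s ⊛ q)
      ≈⟨ P.+-congʳ {(s ++ negP (const t)) ⊛ (const E ++ s ⊛ q)} (const-+ a (t * E)) ⟨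
    const (a + t * E) ++ (s ++ negP (const t)) ⊛ (const E ++ s ⊛ q) ∎
    where
    E = evalU (monic (b ∷ as)) t
    q = univ s (monic (hornerQuotient t as))

  abstract
    -- `algClosed` delivers roots of monic polynomials as data, so no double negation is needed at
    -- this point; it arises only where a leading coefficient has to be found or a root compared
    -- with zero.
    split-monic : ∀ v n as → length as ≡ n →
      Σ (List Carrier) λ ts → length ts ≡ n × univ (mon v) (monic as) ≋ linProd v ts
    split-monic v zero [] eq = [] , ≡.refl ,
      solve 2 (λ o s → o :+ s :* con (+ 0) := o) P.refl (const 1#) (mon v)
    split-monic v (suc n) (a ∷ as) eq with algClosed a as
    ... | t , root with split-monic v n (hornerQuotient t as)
          (≡.trans (hornerQuotient-length t as) (ℕP.suc-injective eq))
    ...   | ts , len , split = t ∷ ts , ≡.cong suc len , (begin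
      univ (mon v) (monic (a ∷ as))
        ≈⟨ divide-linear t (mon v) a as ⟩
      const (evalU (monic (a ∷ as)) t) ++ lin v t ⊛ univ (mon v) (monic (hornerQuotient t as))
        ≈⟨ P.+-cong (P.trans (const-cong root) const-0) (P.*-congˡ {lin v t} split) ⟩
      lin v t ⊛ linProd v ts ∎)

  1^n≈1 : ∀ n → 1# F.^ n ≈ 1#
  1^n≈1 zero = refl
  1^n≈1 (suc n) = trans (*-identityˡ _) (1^n≈1 n)

  mon-^ : ∀ v n → mon v PF.^ n ≋ mon (+ n *² v)
  mon-^ v n = P.trans (monomial-^ 1# v n) (mk≋ λ e u → +-congʳ (*-congʳ (1^n≈1 n)))

  mon-⊛ : ∀ u v → mon (u +² v) ≋ mon u ⊛ mon v
  mon-⊛ u v = mk≋ λ e x → +-congʳ (*-congʳ (sym (*-identityˡ 1#)))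

  univ-power : ∀ s n → univ s (monic (replicate n 0#)) ≋ s PF.^ n
  univ-power s zero = solve 2 (λ o s → o :+ s :* con (+ 0) := o) P.refl (const 1#) s
  univ-power s (suc n) = P.trans (P.+-congʳ {s ⊛ univ s (monic (replicate n 0#))} const-0)
    (P.*-congˡ {s} (univ-power s n))

  abstract
    split-X^m-1 : ∀ m v → Σ (List Carrier) λ ωs → lin (+ suc m *² v) 1# ≋ linProd v ωs
    split-X^m-1 m v with split-monic v _ (- 1# ∷ replicate m 0#) ≡.refl
    ... | ωs , _ , split = ωs , (begin
      mon (+ suc m *² v) ++ const (- 1#)                       ≈⟨ P.+-comm (mon (+ suc m *² v)) (const (- 1#)) ⟩
      const (- 1#) ++ mon (+ suc m *² v)                       ≈⟨ P.+-congˡ {const (- 1#)} (mon-^ v (suc m)) ⟨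
      const (- 1#) ++ mon v ⊛ mon v PF.^ m                     ≈⟨ P.+-congˡ {const (- 1#)}
        (P.*-congˡ {mon v} (univ-power (mon v) m)) ⟨
      univ (mon v) (monic (- 1# ∷ replicate m 0#))             ≈⟨ split ⟩
      linProd v ωs ∎)

  linProd-++ : ∀ v xs ys → linProd v (xs ++ ys) ≋ linProd v xs ⊛ linProd v ys
  linProd-++ v [] ys = P.sym (P.*-identityˡ _)
  linProd-++ v (x ∷ xs) ys = P.trans (P.*-congˡ {lin v x} (linProd-++ v xs ys))
    (P.sym (P.*-assoc (lin v x) (linProd v xs) (linProd v ys)))

  module Congruence (z : Poly) where
    infix 4 _∼_ _by_
    -- Congruence modulo z. The quotient is kept because, when y vanishes, it is the cofactor that
    -- exhibits z as a divisor of x.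
    record _∼_ (x y : Poly) : Set (c ⊔ ℓ) where
      constructor _by_
      field
        quotient : Poly
        congruent : x ≋ y ++ z ⊛ quotient

    ≋⇒∼ : ∀ {x y} → x ≋ y → x ∼ y
    ≋⇒∼ {x} {y} eq = [] by P.trans eq (solve 2 (λ y z → y := y :+ z :* con (+ 0)) P.refl y z)

    ∼-trans : ∀ {x y w} → x ∼ y → y ∼ w → x ∼ w
    ∼-trans {x} {y} {w} (h by eq) (h′ by eq′) = h ++ h′ by (begin
      x                            ≈⟨ eq ⟩
      y ++ z ⊛ h                   ≈⟨ P.+-congʳ {z ⊛ h} eq′ ⟩
      (w ++ z ⊛ h′) ++ z ⊛ h       ≈⟨ solve 4
        (λ w z h h′ → (w :+ z :* h′) :+ z :* h := w :+ z :* (h :+ h′)) P.refl w z h h′ ⟩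
      w ++ z ⊛ (h ++ h′) ∎)

    ∼-+ : ∀ {x y x′ y′} → x ∼ y → x′ ∼ y′ → x ++ x′ ∼ y ++ y′
    ∼-+ {x} {y} {x′} {y′} (h by eq) (h′ by eq′) = h ++ h′ by P.trans (P.+-cong eq eq′)
      (solve 5 (λ y y′ z h h′ → (y :+ z :* h) :+ (y′ :+ z :* h′) := (y :+ y′) :+ z :* (h :+ h′)) P.refl y y′ z h h′)

    ∼-* : ∀ {x y x′ y′} → x ∼ y → x′ ∼ y′ → x ⊛ x′ ∼ y ⊛ y′
    ∼-* {x} {y} {x′} {y′} (h by eq) (h′ by eq′) = (h ⊛ y′ ++ y ⊛ h′) ++ h ⊛ (z ⊛ h′) by P.trans (P.*-cong eq eq′)
      (solve 5 (λ y y′ z h h′ → (y :+ z :* h) :* (y′ :+ z :* h′) := (y :* y′) :+ z :*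
        ((h :* y′ :+ y :* h′) :+ h :* (z :* h′))) P.refl y y′ z h h′)

    ∼-^ : ∀ {x y} n → x ∼ y → x PF.^ n ∼ y PF.^ n
    ∼-^ zero e = ≋⇒∼ P.refl
    ∼-^ (suc n) e = ∼-* e (∼-^ n e)

-- Eliminating variables in favour of X^ε

module Elimination {c ℓ} (K : ACField0 c ℓ) where
  open ACField0 K
  open CommutativeRing cring hiding (zero)
  open RingOps cring
  open OverField K
  open Splitting K
  open PF.Solver using (solve; _:+_; _:*_; _:-_; :-_; _:=_; con)
  open import Relation.Binary.Reasoning.Setoid P.setoid

  record Univariate (s p : Poly) : Set (c ⊔ ℓ) where
    constructor univariate
    field
      coeffs : List Carrier
      expansion : p ≋ univ s coeffs

  addCoeffs : List Carrier → List Carrier → List Carrier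
  addCoeffs []       bs       = bs
  addCoeffs (a ∷ as) []       = a ∷ as
  addCoeffs (a ∷ as) (b ∷ bs) = a + b ∷ addCoeffs as bs

  univ-+ : ∀ s as bs → univ s as ++ univ s bs ≋ univ s (addCoeffs as bs)
  univ-+ s [] bs = P.refl
  univ-+ s (a ∷ as) [] = P.+-identityʳ _
  univ-+ s (a ∷ as) (b ∷ bs) = begin
    (const a ++ s ⊛ univ s as) ++ (const b ++ s ⊛ univ s bs)
      ≈⟨ solve 5 (λ a b s x y → (a :+ s :* x) :+ (b :+ s :* y) := (a :+ b) :+ s :* (x :+ y)) P.refl (const a)
        (const b) s (univ s as) (univ s bs) ⟩
    (const a ++ const b) ++ s ⊛ (univ s as ++ univ s bs)
      ≈⟨ P.+-cong (P.sym (const-+ a b)) (P.*-congˡ {s} (univ-+ s as bs)) ⟩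
    const (a + b) ++ s ⊛ univ s (addCoeffs as bs) ∎

  univ-scale : ∀ s a as → const a ⊛ univ s as ≋ univ s (map (a *_) as)
  univ-scale s a [] = P.zeroʳ (const a)
  univ-scale s a (b ∷ bs) = begin
    const a ⊛ (const b ++ s ⊛ univ s bs)
      ≈⟨ solve 4 (λ a b s x → a :* (b :+ s :* x) := a :* b :+ s :* (a :* x)) P.refl (const a) (const b) s
        (univ s bs) ⟩
    const a ⊛ const b ++ s ⊛ (const a ⊛ univ s bs)
      ≈⟨ P.+-congˡ {const (a * b)} (P.*-congˡ {s} (univ-scale s a bs)) ⟩
    const (a * b) ++ s ⊛ univ s (map (a *_) bs) ∎

  univariate-+ : ∀ {s p q} → Univariate s p → Univariate s q → Univariate s (p ++ q)
  univariate-+ {s} (univariate as eq) (univariate bs eq′) = univariate (addCoeffs as bs)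
    (P.trans (P.+-cong eq eq′) (univ-+ s as bs))

  univariate-const* : ∀ {s p} a → Univariate s p → Univariate s (const a ⊛ p)
  univariate-const* {s} a (univariate as eq) = univariate (map (a *_) as)
    (P.trans (P.*-congˡ {const a} eq) (univ-scale s a as))

  univariate-s* : ∀ {s p} → Univariate s p → Univariate s (s ⊛ p)
  univariate-s* {s} {p} (univariate as eq) = univariate (0# ∷ as)
    (P.trans (P.*-congˡ {s} eq) (P.sym (P.+-congʳ {s ⊛ univ s as} const-0)))

  univariate-≋ : ∀ {s p q} → p ≋ q → Univariate s p → Univariate s q
  univariate-≋ eq (univariate as eq′) = univariate as (P.trans (P.sym eq) eq′)

  univariate-monomial* : ∀ {s p} a i j → Univariate s p → Univariate s ((const a PF.^ i ⊛ s PF.^ j) ⊛ p)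
  univariate-monomial* {s} {p} a zero zero u =
    univariate-≋ (P.sym (P.trans (P.*-congʳ {p} (P.*-identityˡ (const 1#))) (P.*-identityˡ p))) u
  univariate-monomial* {s} {p} a zero (suc j) u =
    univariate-≋ (solve 4 (λ o s x p → s :* ((o :* x) :* p) := (o :* (s :* x)) :* p) P.refl (const 1#) s (s PF.^ j) p)
      (univariate-s* (univariate-monomial* {s} {p} a zero j u))
  univariate-monomial* {s} {p} a (suc i) j u =
    univariate-≋ (solve 4 (λ a x y p → a :* ((x :* y) :* p) := ((a :* x) :* y) :* p) P.refl (const a)
      (const a PF.^ i) (s PF.^ j) p)
      (univariate-const* a (univariate-monomial* {s} {p} a i j u))

  univariate-1 : ∀ s → Univariate s (const 1#)
  univariate-1 s = univariate (1# ∷ []) (solve 2 (λ o s → o := o :+ s :* con (+ 0)) P.refl (const 1#) s)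

  module Reduction (d d′ : ℤ²) (unimodular : det d d′ ≡ + 1) (ω : Carrier) where
    open Congruence (lin d ω)

    mon∼const : mon d ∼ const ω
    mon∼const = const 1# by P.sym (begin
      const ω ++ lin d ω ⊛ const 1#                 ≈⟨ P.+-congˡ {const ω} (P.*-identityʳ (lin d ω)) ⟩
      const ω ++ (mon d ++ negP (const ω))          ≈⟨ solve 2 (λ w m → w :+ (m :- w) := m) P.refl (const ω) (mon d) ⟩
      mon d ∎)

    mon-cone : ∀ i j → mon ((+ i *² d) +² (+ j *² d′)) ∼ const ω PF.^ i ⊛ mon d′ PF.^ j
    mon-cone i j = ∼-trans (≋⇒∼ (begin
      mon ((+ i *² d) +² (+ j *² d′))      ≈⟨ mon-⊛ (+ i *² d) (+ j *² d′) ⟩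
      mon (+ i *² d) ⊛ mon (+ j *² d′)     ≈⟨ P.*-cong (mon-^ d i) (mon-^ d′ j) ⟨
      mon d PF.^ i ⊛ mon d′ PF.^ j         ∎)) (∼-* (∼-^ i mon∼const) (≋⇒∼ P.refl))

    abstract
      -- Modulo X^d − ω every Laurent polynomial becomes, up to a unit, a polynomial in X^{d′}.
      reduce : ∀ g → Σ ℤ² λ w → Σ (List Carrier) λ as → mon w ⊛ g ∼ univ (mon d′) as
      reduce [] = 0² , [] , ≋⇒∼ P.refl
      reduce ((a , u) ∷ g) with reduce g
      ... | w , as , red with cone-shift d d′ unimodular (w +² u)
      ...   | i , j , σ , κ , eq = w′ , Univariate.coeffs both , ∼-trans (≋⇒∼ expand)
            (∼-trans (∼-+ head tail) (≋⇒∼ (Univariate.expansion both)))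
        where
        t w′ : ℤ²
        -- X^t brings the new exponent w + u into the cone spanned by d and d′. On the tail, already
        -- reduced, it acts as ω^i (X^{d′})^j, so the tail remains a polynomial in X^{d′}.
        t = (+ i *² d) +² (+ j *² d′)
        w′ = t +² w
        m₁ m₂ : Poly
        m₁ = const ω PF.^ σ ⊛ mon d′ PF.^ κ
        m₂ = const ω PF.^ i ⊛ mon d′ PF.^ j
        place : w′ +² u ≡ (+ σ *² d) +² (+ κ *² d′)
        place = ≡.trans (+²-assoc t w u) eq
        monomial : mon w′ ⊛ ((a , u) ∷ []) ≋ const a ⊛ mon ((+ σ *² d) +² (+ κ *² d′))
        monomial = mk≋ λ e x → +-congʳ (*-cong (*-comm 1# a)
          (reflexive (≡.cong (λ v → e (x -² v)) (≡.trans place (≡.sym (+²-identityˡ _))))))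
        expand : mon w′ ⊛ ((a , u) ∷ g) ≋ const a ⊛ mon ((+ σ *² d) +² (+ κ *² d′)) ++ mon t ⊛ (mon w ⊛ g)
        expand = begin
          mon w′ ⊛ ((a , u) ∷ [] ++ g)                             ≈⟨ P.distribˡ (mon w′) ((a , u) ∷ []) g ⟩
          mon w′ ⊛ ((a , u) ∷ []) ++ mon w′ ⊛ g                    ≈⟨ P.+-cong monomial
            (P.trans (P.*-congʳ {g} (mon-⊛ t w)) (P.*-assoc (mon t) (mon w) g)) ⟩
          const a ⊛ mon ((+ σ *² d) +² (+ κ *² d′)) ++ mon t ⊛ (mon w ⊛ g) ∎
        head : const a ⊛ mon ((+ σ *² d) +² (+ κ *² d′)) ∼ const a ⊛ (m₁ ⊛ const 1#)
        head = ∼-* (≋⇒∼ {const a} P.refl) (∼-trans (mon-cone σ κ) (≋⇒∼ (P.sym (P.*-identityʳ m₁))))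
        tail : mon t ⊛ (mon w ⊛ g) ∼ m₂ ⊛ univ (mon d′) as
        tail = ∼-* (mon-cone i j) red
        both : Univariate (mon d′) (const a ⊛ (m₁ ⊛ const 1#) ++ m₂ ⊛ univ (mon d′) as)
        both = univariate-+ (univariate-const* a (univariate-monomial* ω σ κ (univariate-1 (mon d′))))
                            (univariate-monomial* ω i j (univariate as P.refl))

  Kills-≋ : ∀ p q {e} → p ≋ q → Kills p e → Kills q e
  Kills-≋ p q eq k u = trans (sym (app eq _ u)) (k u)

  LeadingCoefficient : Poly → List Carrier → Set (c ⊔ ℓ)
  LeadingCoefficient s as = Σ (List Carrier) λ bs → Σ Carrier λ a →
    (¬ a ≈ 0#) × (length bs ℕ.≤ length as) × univ s as ≋ univ s (bs ++ a ∷ [])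

  -- Discarding vanishing top coefficients takes zero tests in K, whence the double negation. The
  -- length of `as` is known beforehand and bounds the degree whatever those tests would say.
  leading : ∀ s as → ¬ ¬ (univ s as ≋ [] ⊎ LeadingCoefficient s as)
  leading s [] k = k (inj₁ P.refl)
  leading s (a ∷ as) k = leading s as λ where
    (inj₂ (bs , b , b≉0 , len , eq)) → k
      (inj₂ (a ∷ bs , b , b≉0 , ℕ.s≤s len , P.+-congˡ {const a} (P.*-congˡ {s} eq)))
    (inj₁ eq) → ¬¬-lem λ where
      (inj₁ a≈0) → k (inj₁ (P.trans (P.+-cong (P.trans (const-cong a≈0) const-0) (P.*-congˡ {s} eq)) (P.zeroʳ s)))
      (inj₂ a≉0) → k (inj₂ ([] , a , a≉0 , ℕ.z≤n , P.+-congˡ {const a} (P.*-congˡ {s} eq)))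

  normalise : ∀ s bs a a⁻¹ → a * a⁻¹ ≈ 1# → const a⁻¹ ⊛ univ s (bs ++ a ∷ []) ≋ univ s (monic (map (a⁻¹ *_) bs))
  normalise s [] a a⁻¹ eq = P.trans (univ-scale s a⁻¹ (a ∷ []))
    (P.+-congʳ {s ⊛ []} (const-cong (trans (*-comm a⁻¹ a) eq)))
  normalise s (b ∷ bs) a a⁻¹ eq = begin
    const a⁻¹ ⊛ (const b ++ s ⊛ univ s (bs ++ a ∷ []))
      ≈⟨ solve 4 (λ a b s x → a :* (b :+ s :* x) := a :* b :+ s :* (a :* x)) P.refl (const a⁻¹) (const b) s
        (univ s (bs ++ a ∷ [])) ⟩
    const (a⁻¹ * b) ++ s ⊛ (const a⁻¹ ⊛ univ s (bs ++ a ∷ []))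
      ≈⟨ P.+-congˡ {const (a⁻¹ * b)} (P.*-congˡ {s} (normalise s bs a a⁻¹ eq)) ⟩
    const (a⁻¹ * b) ++ s ⊛ univ s (monic (map (a⁻¹ *_) bs)) ∎

  module Direction (ε : ℤ²) where

    -- On the common kernel of b and f, X^ε satisfies the monic polynomial with roots ξs. In use b
    -- stays fixed while f runs through the factors of a product.
    Eliminates : Poly → Poly → List Carrier → Set (c ⊔ ℓ)
    Eliminates b f ξs = ∀ e → Kills b e → Kills f e → Kills (linProd ε ξs) e

    -- Equality in K is undecidable, so the roots exist only classically; the bound n on
    -- their number is nevertheless explicit, and the period below depends on n alone.
    Elim : Poly → ℕ → Poly → Set (c ⊔ ℓ)
    Elim b n f = ¬ ¬ (Σ (List Carrier) λ ξs → length ξs ℕ.≤ n × Eliminates b f ξs)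

    elim-const1 : ∀ b → Elim b 0 (const 1#)
    elim-const1 b k = k ([] , ℕ.z≤n , λ e _ kf → kf)

    -- If f h e = 0, the roots for f serve the configuration h e. As polynomials commute, h then
    -- kills what those roots leave of e, and the roots for h finish it off.
    elim-⊛ : ∀ b f h {m n} → Elim b m f → Elim b n h → Elim b (m ℕ.+ n) (f ⊛ h)
    elim-⊛ b f h {m} {n} ef eh k = ef λ (ξs , lξ , kξ) → eh λ (ζs , lζ , kζ) →
      k (ξs ++ ζs , ≡.subst (ℕ._≤ m ℕ.+ n) (≡.sym (ListP.length-++ ξs)) (ℕP.+-mono-≤ lξ lζ) , λ e kb kfh →
        let kξh : Kills (linProd ε ξs ⊛ h) e
            kξh u = trans (act-⊛ (linProd ε ξs) h e u)
              (kξ (act h e) (Kills-act b h kb) (λ u → trans (sym (act-⊛ f h e u)) (kfh u)) u)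
            khξ : Kills h (act (linProd ε ξs) e)
            khξ u = trans (act-comm h (linProd ε ξs) e u) (trans (sym (act-⊛ (linProd ε ξs) h e u)) (kξh u))
            kζξ : Kills (linProd ε ζs) (act (linProd ε ξs) e)
            kζξ = kζ (act (linProd ε ξs) e) (Kills-act b (linProd ε ξs) kb) khξ
        in Kills-≋ (linProd ε ξs ⊛ linProd ε ζs) (linProd ε (ξs ++ ζs)) (P.sym (linProd-++ ε ξs ζs)) (λ u →
             trans (act-⊛ (linProd ε ξs) (linProd ε ζs) e u)
               (trans (act-comm (linProd ε ξs) (linProd ε ζs) e u) (kζξ u))))

    elim-imp : ∀ b f h {n} → (∀ e → Kills b e → Kills f e → Kills h e) → Elim b n h → Elim b n f
    elim-imp b f h imp eh k = eh λ (ξs , l , kξ) → k (ξs , l , λ e kb kf → kξ e kb (imp e kb kf))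

    elim-linProd : ∀ b v ts → (∀ t → Elim b 1 (lin v t)) → Elim b (length ts) (linProd v ts)
    elim-linProd b v [] h = elim-const1 b
    elim-linProd b v (t ∷ ts) h = elim-⊛ b (lin v t) (linProd v ts) (h t) (elim-linProd b v ts h)

    vanish : ∀ b n f → (∀ e → Kills b e → Kills f e → ∀ u → e u ≈ 0#) → Elim b n f
    vanish b n f h k = k ([] , ℕ.z≤n , λ e kb kf u → trans (act-const 1# e u) (trans (*-identityˡ _) (h e kb kf u)))

    -- In the basis (d , d′) the vector ε has coordinates `det ε d′` and `det d ε`, so X^ε acts as
    -- the product of these powers of ω and τ. Negative powers need ω and τ nonzero; if either is
    -- zero, the common kernel is zero.
    elim-eigen : ∀ d d′ → det d d′ ≡ + 1 → ∀ ω τ → Elim (lin d ω) 1 (lin d′ τ)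
    elim-eigen d d′ uni ω τ k = ¬¬-lem λ where
      (inj₁ ω≈0) → vanish (lin d ω) 1 (lin d′ τ) (λ e kω _ → eigen-0 ω≈0 (lin⇒eigen kω)) k
      (inj₂ ω≉0) → ¬¬-lem λ where
        (inj₁ τ≈0) → vanish (lin d ω) 1 (lin d′ τ) (λ e _ kτ → eigen-0 τ≈0 (lin⇒eigen kτ)) k
        (inj₂ τ≉0) → let (α , hα) = eigen-ℤ* d ω ω≉0 (det ε d′)
                         (β , hβ) = eigen-ℤ* d′ τ τ≉0 (det d ε)
          in k (α * β ∷ [] , ℕ.s≤s ℕ.z≤n , λ e kω kτ →
            Kills-≋ (lin ε (α * β)) (linProd ε (α * β ∷ [])) {e} (P.sym (P.*-identityʳ (lin ε (α * β))))
              (eigen⇒lin (≡.subst (λ w → Eigen w (α * β) e) (≡.sym (basis-coordinates d d′ uni ε))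
                (eigen-+ (hα e (lin⇒eigen kω)) (hβ e (lin⇒eigen kτ))))))

    abstract
      -- `reduce` needs no zero test, so the length of `as` is available as the bound before the
      -- double negation is entered.
      elim-lin : ∀ g → ¬ L.HasLinePolyFactor g → ∀ d d′ → det d d′ ≡ + 1 → ∀ ω → Σ ℕ λ n → Elim g n (lin d ω)
      elim-lin g noFactor d d′ uni ω with Reduction.reduce d d′ uni ω g
      ... | w , as , (h Congruence.by red) = length as , λ k → ¬¬-lem λ where
          (inj₁ ω≈0) → vanish g (length as) (lin d ω) (λ e _ kω → eigen-0 ω≈0 (lin⇒eigen kω)) k
          (inj₂ ω≉0) → leading (mon d′) as λ where
            (inj₁ eq) → noFactor (lin d ω , lin-isLine d ω d≢0 ω≉0 , ∣L-intro (lin d ω) (mon (-² w) ⊛ h) g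
              (quotient-eq eq))
            (inj₂ lead) → nonzero lead k
        where
        d≢0 : d ≢ 0²
        d≢0 eq with ≡.subst (λ v → det v d′ ≡ + 1) eq uni
        ... | ()
        mon-inverse : mon (-² w) ⊛ mon w ≋ const 1#
        mon-inverse = P.trans (P.sym (mon-⊛ (-² w) w))
          (mk≋ λ e u → +-congʳ (*-congˡ (reflexive (≡.cong (λ v → e (u -² v)) (+²-inverseˡ w)))))
        quotient-eq : univ (mon d′) as ≋ [] → lin d ω ⊛ (mon (-² w) ⊛ h) ≋ g
        quotient-eq eq = begin
          lin d ω ⊛ (mon (-² w) ⊛ h)
            ≈⟨ solve 3 (λ l m h → l :* (m :* h) := m :* (l :* h)) P.refl (lin d ω) (mon (-² w)) h ⟩
          mon (-² w) ⊛ (lin d ω ⊛ h)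
            ≈⟨ P.*-congˡ {mon (-² w)} (P.trans red (P.+-congʳ {lin d ω ⊛ h} eq)) ⟨
          mon (-² w) ⊛ (mon w ⊛ g)
            ≈⟨ P.*-assoc (mon (-² w)) (mon w) g ⟨
          (mon (-² w) ⊛ mon w) ⊛ g
            ≈⟨ P.trans (P.*-congʳ {g} mon-inverse) (P.*-identityˡ g) ⟩
          g ∎
        nonzero : LeadingCoefficient (mon d′) as → Elim g (length as) (lin d ω)
        nonzero (bs , a , a≉0 , len , eq) k =
          -- The fixed polynomial changes from g to X^d - ω: g has served its purpose in producing
          -- the factors X^{d′} - τ, each of which is now paired with X^d - ω.
          elim-linProd (lin d ω) d′ τs (elim-eigen d d′ uni ω) λ (ξs , lξ , kξ) →
            k (ξs , ℕP.≤-trans lξ lenτs , λ e kg kω → kξ e kω (killed e kg kω))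
          where
          a⁻¹ : Carrier
          a⁻¹ = proj₁ (inverse a a≉0)
          cs : List Carrier
          cs = map (a⁻¹ *_) bs
          splitting : Σ (List Carrier) λ ts → length ts ≡ length cs × univ (mon d′) (monic cs) ≋ linProd d′ ts
          splitting = split-monic d′ (length cs) cs ≡.refl
          τs : List Carrier
          τs = proj₁ splitting
          lenτs : length τs ℕ.≤ length as
          lenτs = ℕP.≤-trans (ℕP.≤-reflexive (≡.trans (proj₁ (proj₂ splitting)) (ListP.length-map (a⁻¹ *_) bs))) len
          killed-univ : ∀ e → Kills g e → Kills (lin d ω) e → Kills (univ (mon d′) as) e
          killed-univ e kg kω u = trans (sym (trans (+-congˡ (Kills-⊛ʳ (lin d ω) h kω u)) (+-identityʳ _)))
                (trans (sym (act-++ (univ (mon d′) as) (lin d ω ⊛ h) e u))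
                  (trans (sym (app red e u)) (Kills-⊛ˡ g (mon w) kg u)))
          to-linProd : const a⁻¹ ⊛ univ (mon d′) as ≋ linProd d′ τs
          to-linProd = P.trans (P.*-congˡ {const a⁻¹} eq)
            (P.trans (normalise (mon d′) bs a a⁻¹ (proj₂ (inverse a a≉0))) (proj₂ (proj₂ splitting)))
          killed : ∀ e → Kills g e → Kills (lin d ω) e → Kills (linProd d′ τs) e
          killed e kg kω = Kills-≋ (const a⁻¹ ⊛ univ (mon d′) as) (linProd d′ τs) to-linProd
            (Kills-⊛ˡ (univ (mon d′) as) (const a⁻¹) (killed-univ e kg kω))

      elim-split : ∀ g d ωs → (∀ ω → Σ ℕ λ n → Elim g n (lin d ω)) → Σ ℕ λ n → Elim g n (linProd d ωs)
      elim-split g d [] h = 0 , elim-const1 g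
      elim-split g d (ω ∷ ωs) h with h ω | elim-split g d ωs h
      ... | m , eω | n , eωs = m ℕ.+ n , elim-⊛ g (lin d ω) (linProd d ωs) eω eωs

    difference : ℤ² × ℤ² → Poly
    difference (α , β) = (1# , α) ∷ (- 1# , β) ∷ []

    act-difference : ∀ α β e u → act (difference (α , β)) e u ≈ e (u -² α) - e (u -² β)
    act-difference α β e u = +-cong (*-identityˡ _)
      (trans (+-identityʳ _) (trans (sym (F.-‿distribˡ-* 1# _)) (-‿cong (*-identityˡ _))))

    -- X^α - X^β = X^β (X^{α-β} - 1), and X^β is invertible.
    difference⇒periodic : ∀ α β e → Kills (difference (α , β)) e → Kills (lin (α -² β) 1#) e
    difference⇒periodic α β e k = eigen⇒lin λ u → trans (reflexive (≡.cong e (-²-split u α β)))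
      (trans (F.x∙y⁻¹≈ε⇒x≈y _ _ (trans (sym (act-difference α β e (u +² β))) (k (u +² β))))
        (trans (reflexive (≡.cong e (+²-cancel u β))) (sym (*-identityˡ _))))

    abstract
      elim-difference : ∀ g → ¬ L.HasLinePolyFactor g → ∀ α β → α ≢ β → Σ ℕ λ n → Elim g n (difference (α , β))
      elim-difference g noFactor α β α≢β = proj₁ eliminated , elim-imp g (difference (α , β))
        (linProd d ωs) to-linProd (proj₂ eliminated)
        where
        open PrimitiveBasis (primitiveBasis (α -² β) (λ eq → α≢β (-²≡0⇒≡ α β eq)))
        ωs : List Carrier
        ωs = proj₁ (split-X^m-1 index d)
        eliminated : Σ ℕ λ n → Elim g n (linProd d ωs)
        eliminated = elim-split g d ωs (elim-lin g noFactor d d′ unimodular)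
        to-linProd : ∀ e → Kills g e → Kills (difference (α , β)) e → Kills (linProd d ωs) e
        to-linProd e _ k = Kills-≋ (lin (+ suc index *² d) 1#) (linProd d ωs) (proj₂ (split-X^m-1 index d))
          (≡.subst (λ v → Kills (lin v 1#) e) multiple (difference⇒periodic α β e k))

    differenceProd : List (ℤ² × ℤ²) → Poly
    differenceProd []      = const 1#
    differenceProd (x ∷ V) = difference x ⊛ differenceProd V

    diffs-act : ∀ V e u → act (differenceProd V) e u ≈ diffs V e u
    diffs-act [] e u = trans (act-const 1# e u) (*-identityˡ _)
    diffs-act ((α , β) ∷ V) e u = trans (act-⊛ (difference (α , β)) (differenceProd V) e u)
      (trans (act-difference α β (act (differenceProd V) e) u)
        (+-cong (diffs-act V e (u -² α)) (-‿cong (diffs-act V e (u -² β)))))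

    abstract
      elim-diffs : ∀ g → ¬ L.HasLinePolyFactor g → ∀ V → All (λ (α , β) → α ≢ β) V →
        Σ ℕ λ n → Elim g n (differenceProd V)
      elim-diffs g noFactor [] [] = 0 , elim-const1 g
      elim-diffs g noFactor ((α , β) ∷ V) (ne ∷ nes) =
        proj₁ first ℕ.+ proj₁ rest , elim-⊛ g (difference (α , β)) (differenceProd V) (proj₂ first) (proj₂ rest)
        where
        first : Σ ℕ λ n → Elim g n (difference (α , β))
        first = elim-difference g noFactor α β ne
        rest : Σ ℕ λ n → Elim g n (differenceProd V)
        rest = elim-diffs g noFactor V nes

-- Coverings as integer configurations

bit : Bool → ℤ
bit c = if c then + 1 else + 0

-- An integer copy of g, on which congruences modulo p make sense; `lifts-g` matches it term by term
-- with the polynomial over K.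
gℤ : List ℤ² → ℕ → ℕ → ZG.Poly
gℤ D b a = map (λ u → + 1 , -² u) D ++ (+ a , 0²) ∷ (ℤ.- + b , 0²) ∷ []

step : ℤ² → Config → ℤ² → ℤ
step ε c u = bit (c (u -² ε)) ℤ.- bit (c u)

step-bounded : ∀ ε c u → ∣ step ε c u ∣ ℕ.≤ 1
step-bounded ε c u with c (u -² ε) | c u
... | true  | true  = ℕ.z≤n
... | true  | false = ℕP.≤-refl
... | false | true  = ℕP.≤-refl
... | false | false = ℕ.z≤n

act-count : ∀ c D u → ZG.act (map (λ v → + 1 , -² v) D) (λ x → bit (c x)) u ≡ + count c D u
act-count c [] u = ≡.refl
act-count c (v ∷ D) u = ≡.trans
  (≡.cong₂ ℤ._+_ (≡.trans (ℤP.*-identityˡ _)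
    (≡.trans (≡.cong (λ w → bit (c w)) (-²-neg u v)) (bit-if (c (u +² v))))) (act-count c D u))
  (≡.sym (ℤP.pos-+ (if c (u +² v) then 1 else 0) (count c D u)))
  where
  bit-if : ∀ t → bit t ≡ + (if t then 1 else 0)
  bit-if true  = ≡.refl
  bit-if false = ≡.refl

-- The term a - b levels the two cases: where c is 1 the sum is b + (a - b), and where c is 0 it is
-- a.
act-covering : ∀ D b a c → IsCovering D b a c → ∀ u → ZG.act (gℤ D b a) (λ x → bit (c x)) u ≡ + a
act-covering D b a c cov u = ≡.trans (ZG.act-++ (map (λ v → + 1 , -² v) D) _ _ u)
  (≡.trans (≡.cong₂ ℤ._+_ (≡.trans (act-count c D u) (≡.cong +_ (cov u)))
                          (≡.cong (λ w → + a ℤ.* bit (c w) ℤ.+ (ℤ.- + b ℤ.* bit (c w) ℤ.+ + 0)) (-²-identity u)))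
           (balance (c u)))
  where
  balance : ∀ t → + (if t then b else a) ℤ.+ (+ a ℤ.* bit t ℤ.+ (ℤ.- + b ℤ.* bit t ℤ.+ + 0)) ≡ + a
  balance true  = Z.solve 2 (λ a b → b Z.:+ (a Z.:* Z.con (+ 1) Z.:+ (Z.:- b Z.:* Z.con (+ 1) Z.:+ Z.con (+ 0)))
    Z.:= a) ≡.refl (+ a) (+ b)
  balance false = Z.solve 2 (λ a b → a Z.:+ (a Z.:* Z.con (+ 0) Z.:+ (Z.:- b Z.:* Z.con (+ 0) Z.:+ Z.con (+ 0)))
    Z.:= a) ≡.refl (+ a) (+ b)

-- X^ε - 1 commutes with g and kills the constant configuration g c.
step-killed : ∀ D b a ε c → IsCovering D b a c → ZG.Kills (gℤ D b a) (step ε c)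
step-killed D b a ε c cov u = ≡.trans (ZG.act-cong g (λ x → ≡.sym (act-q (λ y → bit (c y)) x)) u)
  (≡.trans (ZG.act-comm g q (λ x → bit (c x)) u)
    (≡.trans (ZG.act-cong q (act-covering D b a c cov) u)
      (≡.trans (act-q (λ _ → + a) u) (ℤP.+-inverseʳ (+ a)))))
  where
  g q : ZG.Poly
  g = gℤ D b a
  q = (+ 1 , ε) ∷ (-[1+ 0 ] , 0²) ∷ []
  act-q : ∀ e x → ZG.act q e x ≡ e (x -² ε) ℤ.- e x
  act-q e x = ≡.trans (≡.cong (λ w → + 1 ℤ.* e (x -² ε) ℤ.+ (-[1+ 0 ] ℤ.* e w ℤ.+ + 0)) (-²-identity x))
    (Z.solve 2 (λ y z → Z.con (+ 1) Z.:* y Z.:+ (Z.con -[1+ 0 ] Z.:* z Z.:+ Z.con (+ 0)) Z.:= y Z.:- z) ≡.refl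
      (e (x -² ε)) (e x))

coefℤ-∉ : ∀ f u → ¬ Any (λ t → proj₂ t ≡ u) f → coefℤ f u ≡ + 0
coefℤ-∉ [] u h = ≡.refl
coefℤ-∉ ((z , v) ∷ f) u h with v ≟² u
... | yes eq = ⊥-elim (h (here eq))
... | no _   = coefℤ-∉ f u (λ i → h (there i))

-- Only exponents listed in f can have a nonzero coefficient, and integers can be compared. Whole
-- coefficients are tested, not single terms, since terms with equal exponents may cancel.
support? : ∀ f → (Σ ℤ² λ v → coefℤ f v ≢ + 0) ⊎ (∀ u → coefℤ f u ≡ + 0)
support? f with all? (λ t → coefℤ f (proj₂ t) ℤ.≟ + 0) f
... | no ¬all = inj₁ (witness (¬All⇒Any¬ (λ t → coefℤ f (proj₂ t) ℤ.≟ + 0) f ¬all))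
  where
  witness : ∀ {f′} → Any (λ t → coefℤ f (proj₂ t) ≢ + 0) f′ → Σ ℤ² λ v → coefℤ f v ≢ + 0
  witness (here {t} ne) = proj₂ t , ne
  witness (there i)     = witness i
... | yes all = inj₂ zero-at
  where
  found : ∀ {f′ u} → All (λ t → coefℤ f (proj₂ t) ≡ + 0) f′ → Any (λ t → proj₂ t ≡ u) f′ → coefℤ f u ≡ + 0
  found (eq ∷ _) (here ≡.refl) = eq
  found (_ ∷ al) (there i)     = found al i
  zero-at : ∀ u → coefℤ f u ≡ + 0
  zero-at u with Any.any? (λ t → proj₂ t ≟² u) f
  ... | yes i = found all i
  ... | no ¬i = coefℤ-∉ f u ¬i

-- Transfer of the integer relations to K

module Transfer {c ℓ} (K : ACField0 c ℓ) where
  open ACField0 K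
  open CommutativeRing cring hiding (zero)
  open RingOps cring
  open OverField K
  module Dℤ = Differences ℤP.+-*-commutativeRing
  open import Relation.Binary.Reasoning.Setoid setoid

  Lifts : ZG.Poly → Poly → Set (c ⊔ ℓ)
  Lifts = Pointwise λ (z , v) (a , w) → (a ≈ F.ofℤ z) × w ≡ v

  ι-⨉ : ∀ n → ι n ≈ n F.⨉ 1#
  ι-⨉ zero    = refl
  ι-⨉ (suc n) = +-congˡ (ι-⨉ n)

  lifts-g : ∀ D b a → Lifts (gℤ D b a) (L.gPoly D b a)
  lifts-g [] b a = (ι-⨉ a , ≡.refl)
    ∷ (trans (-‿cong (ι-⨉ b)) (sym (F.ofℤ-neg (+ b))) , ≡.refl) ∷ []
  lifts-g (v ∷ D) b a = (sym (+-identityʳ 1#) , ≡.refl) ∷ lifts-g D b a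

  act-lifts : ∀ {f g} → Lifts f g → ∀ e u → act g (λ x → F.ofℤ (e x)) u ≈ F.ofℤ (ZG.act f e u)
  act-lifts [] e u = refl
  act-lifts {(z , v) ∷ f} ((eq , ≡.refl) ∷ l) e u = sym (begin
    F.ofℤ (z ℤ.* e (u -² v) ℤ.+ ZG.act f e u)          ≈⟨ F.ofℤ-+ (z ℤ.* e (u -² v)) (ZG.act f e u) ⟩
    F.ofℤ (z ℤ.* e (u -² v)) + F.ofℤ (ZG.act f e u)    ≈⟨ +-cong
      (trans (F.ofℤ-* z (e (u -² v))) (*-congʳ (sym eq))) (sym (act-lifts l e u)) ⟩
    _ ∎)

  coeff-lifts : ∀ {f g} → Lifts f g → ∀ u → L.coeff g u ≈ F.ofℤ (coefℤ f u)
  coeff-lifts [] u = refl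
  coeff-lifts {(z , v) ∷ f} ((eq , ≡.refl) ∷ l) u with v ≟² u
  ... | yes _ = trans (+-cong eq (coeff-lifts l u)) (sym (F.ofℤ-+ z (coefℤ f u)))
  ... | no _  = coeff-lifts l u

  diffs-ofℤ : ∀ V e u → diffs V (λ x → F.ofℤ (e x)) u ≈ F.ofℤ (Dℤ.diffs V e u)
  diffs-ofℤ [] e u = refl
  diffs-ofℤ ((α , β) ∷ V) e u = trans (+-cong (diffs-ofℤ V e (u -² α)) (-‿cong (diffs-ofℤ V e (u -² β))))
    (sym (trans (F.ofℤ-+ (Dℤ.diffs V e (u -² α)) _) (+-congˡ (F.ofℤ-neg (Dℤ.diffs V e (u -² β))))))

  -- Zero is a multiple of the line polynomial x - 1. The absence of line factors therefore also
  -- provides the nonzero coefficient that the isolation argument starts from.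
  zero⇒lineFactor : ∀ g → (∀ u → L.coeff g u ≈ 0#) → L.HasLinePolyFactor g
  zero⇒lineFactor g z = lin (+ 1 , + 0) 1# , lin-isLine (+ 1 , + 0) 1# (λ ()) (λ eq → 0≉1 (sym eq)) , [] , λ u →
    sym (z u)

  bitK : Config → Cfg
  bitK c u = F.ofℤ (bit (c u))

  bitK-injective : ∀ s t → F.ofℤ (bit s) ≈ F.ofℤ (bit t) → s ≡ t
  bitK-injective true  true  eq = ≡.refl
  bitK-injective true  false eq = ⊥-elim (0≉1 (sym (trans (sym (+-identityʳ 1#)) eq)))
  bitK-injective false true  eq = ⊥-elim (0≉1 (trans eq (+-identityʳ 1#)))
  bitK-injective false false eq = ≡.refl

  open Splitting K
  open Elimination K

  module _ (ε : ℤ²) where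
    open Direction ε

    step-bitK : ∀ c u → F.ofℤ (step ε c u) ≈ act (lin ε 1#) (bitK c) u
    step-bitK c u = trans (F.ofℤ-+ (bit (c (u -² ε))) _)
      (trans (+-congˡ (trans (F.ofℤ-neg (bit (c u))) (-‿cong (sym (*-identityˡ _)))))
             (sym (act-lin ε 1# (bitK c) u)))

    AnnihilatorBound : List ℤ² → ℕ → ℕ → Set (c ⊔ ℓ)
    AnnihilatorBound D b a = Σ ℕ λ n → ∀ c → IsCovering D b a c →
      ¬ ¬ (Σ (List Carrier) λ ξs → length ξs ℕ.≤ n × Kills (linProd ε ξs) (bitK c))

    abstract
      covering-annihilator : ∀ D b a → ¬ L.HasLinePolyFactor (L.gPoly D b a) → AnnihilatorBound D b a
      covering-annihilator D b a noFactor = build (support? f)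
        where
        f : ZG.Poly
        f = gℤ D b a
        g : Poly
        g = L.gPoly D b a
        build : (Σ ℤ² λ v → coefℤ f v ≢ + 0) ⊎ (∀ u → coefℤ f u ≡ + 0) → AnnihilatorBound D b a
        build (inj₂ z) = ⊥-elim (noFactor (zero⇒lineFactor g λ u →
          trans (coeff-lifts (lifts-g D b a) u) (reflexive (≡.cong F.ofℤ (z u)))))
        -- The additional root 1 stands for the factor X^ε - 1 that turned c into e.
        build (inj₁ (v₀ , ne)) = suc (proj₁ elim) , λ c cov k → proj₂ elim λ (ξs , len , kξ) →
          k (1# ∷ ξs , ℕ.s≤s len , finish c cov ξs kξ)
          where
          V : List (ℤ² × ℤ²)
          V = proj₁ (differenceAnnihilator f v₀ ne)
          elim : Σ ℕ λ n → Elim g n (differenceProd V)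
          elim = elim-diffs g noFactor V (proj₁ (proj₂ (differenceAnnihilator f v₀ ne)))
          finish : ∀ c → IsCovering D b a c → ∀ ξs → Eliminates g (differenceProd V) ξs →
            Kills (linProd ε (1# ∷ ξs)) (bitK c)
          finish c cov ξs kξ u = trans (act-⊛ (lin ε 1#) (linProd ε ξs) (bitK c) u)
            (trans (act-comm (lin ε 1#) (linProd ε ξs) (bitK c) u)
              (trans (act-cong (linProd ε ξs) (λ x → sym (step-bitK c x)) u)
                (kξ (λ x → F.ofℤ (step ε c x)) killed-g killed-V u)))
            where
            killed-g : Kills g (λ x → F.ofℤ (step ε c x))
            killed-g x = trans (act-lifts (lifts-g D b a) (step ε c) x)
              (reflexive (≡.cong F.ofℤ (step-killed D b a ε c cov x)))
            killed-V : Kills (differenceProd V) (λ x → F.ofℤ (step ε c x))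
            killed-V x = trans (diffs-act V _ x) (trans (diffs-ofℤ V (step ε c) x) (reflexive (≡.cong F.ofℤ
              (proj₂ (proj₂ (differenceAnnihilator f v₀ ne)) (step ε c) (step-bounded ε c)
                (step-killed D b a ε c cov) x))))

-- Linear recurrences along a direction

infixl 6 _↓[_]_
_↓[_]_ : ℤ² → ℤ² → ℕ → ℤ²
u ↓[ ε ] i = u -² (+ i *² ε)

↓-+ : ∀ u ε i j → (u ↓[ ε ] i) ↓[ ε ] j ≡ u ↓[ ε ] (i ℕ.+ j)
↓-+ (x , y) (a , b) i j = ≡.cong₂ _,_ (arith x a) (arith y b)
  where
  arith : ∀ x a → (x ℤ.- + i ℤ.* a) ℤ.- + j ℤ.* a ≡ x ℤ.- + (i ℕ.+ j) ℤ.* a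
  arith x a = ≡.trans (Z.solve 4 (λ x a i j → (x Z.:- i Z.:* a) Z.:- j Z.:* a Z.:= x Z.:- (i Z.:+ j) Z.:* a)
    ≡.refl x a (+ i) (+ j))
                      (≡.cong (λ k → x ℤ.- k ℤ.* a) (≡.sym (ℤP.pos-+ i j)))

↓-1 : ∀ u ε i → (u ↓[ ε ] i) -² ε ≡ u ↓[ ε ] suc i
↓-1 u ε@(a , b) i = ≡.trans (≡.cong (λ w → (u ↓[ ε ] i) -² w)
  (≡.cong₂ _,_ (≡.sym (ℤP.*-identityˡ a)) (≡.sym (ℤP.*-identityˡ b))))
  (≡.trans (↓-+ u ε i 1) (≡.cong (λ n → u ↓[ ε ] n) (ℕP.+-comm i 1)))

↓-0 : ∀ u ε → u ↓[ ε ] 0 ≡ u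
↓-0 u ε = ≡.trans (≡.cong (λ w → u -² w) (0-*² ε)) (-²-identity u)

module Recurrence {c ℓ} (K : ACField0 c ℓ) where
  open ACField0 K
  open CommutativeRing cring hiding (zero)
  open OverField K
  open Splitting K
  open Transfer K
  open import Relation.Binary.Reasoning.Setoid setoid

  -- Induction on the factors: (X^ε - ξ) z obeys a recurrence of order one less and vanishes on the
  -- window shortened by one place, so it vanishes along the ray. Each value of z is then ξ times
  -- the one before.
  recurrence-vanishes : ∀ ε ξs z u → Kills (linProd ε ξs) z →
    (∀ i → i ℕ.< length ξs → z (u ↓[ ε ] i) ≈ 0#) → ∀ i → z (u ↓[ ε ] i) ≈ 0#
  recurrence-vanishes ε [] z u k init i = trans (sym (trans (act-const 1# z (u ↓[ ε ] i)) (*-identityˡ _)))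
    (k (u ↓[ ε ] i))
  recurrence-vanishes ε (ξ ∷ ξs) z u k init = go
    where
    z′ : Cfg
    z′ = act (lin ε ξ) z
    z′-step : ∀ i → z′ (u ↓[ ε ] i) ≈ z (u ↓[ ε ] suc i) - ξ * z (u ↓[ ε ] i)
    z′-step i = trans (act-lin ε ξ z (u ↓[ ε ] i)) (+-congʳ (reflexive (≡.cong z (↓-1 u ε i))))
    z′-killed : Kills (linProd ε ξs) z′
    z′-killed x = trans (act-comm (linProd ε ξs) (lin ε ξ) z x)
      (trans (sym (act-⊛ (lin ε ξ) (linProd ε ξs) z x)) (k x))
    z′-vanishes : ∀ i → z′ (u ↓[ ε ] i) ≈ 0#
    z′-vanishes = recurrence-vanishes ε ξs z′ u z′-killed λ i i< → trans (z′-step i)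
      (trans (+-cong (init (suc i) (ℕ.s≤s i<)) (-‿cong (trans (*-congˡ (init i (ℕP.m<n⇒m<1+n i<))) (zeroʳ ξ))))
        (-‿inverseʳ 0#))
    go : ∀ i → z (u ↓[ ε ] i) ≈ 0#
    go zero    = init 0 (ℕ.s≤s ℕ.z≤n)
    go (suc i) = trans (F.x∙y⁻¹≈ε⇒x≈y _ _ (trans (sym (z′-step i)) (z′-vanishes i)))
      (trans (*-congˡ (go i)) (zeroʳ ξ))

  -- The difference between c and its translate by hε obeys the same recurrence and vanishes on a
  -- window.
  windows-determine : ∀ ε ξs c → Kills (linProd ε ξs) (bitK c) → ∀ u h →
    (∀ k → k ℕ.< length ξs → c (u ↓[ ε ] (h ℕ.+ k)) ≡ c (u ↓[ ε ] k)) →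
    ∀ k → c (u ↓[ ε ] (h ℕ.+ k)) ≡ c (u ↓[ ε ] k)
  windows-determine ε ξs c kc u h win k = bitK-injective _ _
    (F.x∙y⁻¹≈ε⇒x≈y _ _ (trans (sym (z-at k)) (recurrence-vanishes ε ξs z u z-killed init k)))
    where
    z : Cfg
    z = act (lin (+ h *² ε) 1#) (bitK c)
    z-killed : Kills (linProd ε ξs) z
    z-killed = Kills-act (linProd ε ξs) (lin (+ h *² ε) 1#) kc
    z-at : ∀ k → z (u ↓[ ε ] k) ≈ bitK c (u ↓[ ε ] (h ℕ.+ k)) - bitK c (u ↓[ ε ] k)
    z-at k = trans (act-lin (+ h *² ε) 1# (bitK c) (u ↓[ ε ] k))
      (+-cong (reflexive (≡.cong (bitK c) (≡.trans (↓-+ u ε k h) (≡.cong (λ n → u ↓[ ε ] n) (ℕP.+-comm k h)))))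
              (-‿cong (*-identityˡ _)))
    init : ∀ k → k ℕ.< length ξs → z (u ↓[ ε ] k) ≈ 0#
    init k k< = trans (z-at k) (trans (+-congʳ (reflexive (≡.cong (λ t → F.ofℤ (bit t)) (win k k<)))) (-‿inverseʳ _))

-- Coding binary words, and the pigeonhole period

boolToFin : Bool → Fin 2
boolToFin true  = Fin.suc Fin.zero
boolToFin false = Fin.zero

finToBool : Fin 2 → Bool
finToBool Fin.zero    = false
finToBool (Fin.suc _) = true

finToBool-boolToFin : ∀ t → finToBool (boolToFin t) ≡ t
finToBool-boolToFin true  = ≡.refl
finToBool-boolToFin false = ≡.refl

encode : ∀ n → (Fin n → Bool) → Fin (2 ℕ.^ n)
encode n w = funToFin (boolToFin ∘ w)

decodeFin : ∀ n → Fin (2 ℕ.^ n) → Fin n → Bool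
decodeFin n k i = finToBool (finToFun k i)

decodeFin-encode : ∀ n w i → decodeFin n (encode n w) i ≡ w i
decodeFin-encode n w i = ≡.trans (≡.cong finToBool (FinP.finToFun-funToFin (boolToFin ∘ w) i))
  (finToBool-boolToFin (w i))

encode-injective : ∀ n w w′ → encode n w ≡ encode n w′ → ∀ i → w i ≡ w′ i
encode-injective n w w′ eq i = ≡.trans (≡.sym (decodeFin-encode n w i))
  (≡.trans (≡.cong (λ k → decodeFin n k i) eq) (decodeFin-encode n w′ i))

Shift : ℤ² → Config → Set
Shift w c = ∀ u → c (u -² w) ≡ c u

module _ {c ℓ} (K : ACField0 c ℓ) where
  open ACField0 K
  open CommutativeRing cring using (Carrier)
  open OverField K
  open Splitting K
  open Transfer K
  open Recurrence K

  -- Among M + 1 windows, with M = 2^n, two coincide at a distance h ≤ M. This h depends on c and on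
  -- the ray, so the common multiple M! is taken as period. Windows have the length n of the bound,
  -- not that of ξs, so M is known in advance.
  annihilated⇒periodic : ∀ ε ξs n → length ξs ℕ.≤ n → ∀ c → Kills (linProd ε ξs) (bitK c) →
    Shift (+ ((2 ℕ.^ n) !) *² ε) c
  annihilated⇒periodic ε ξs n len c kc u = from (FinP.pigeonhole (ℕP.n<1+n M) code)
    where
    M : ℕ
    M = 2 ℕ.^ n
    u₀ : ℤ²
    -- A coincidence of windows propagates only in the direction -ε. Starting M steps before u
    -- guarantees that u comes no earlier than the first of the two equal windows.
    u₀ = u +² (+ M *² ε)
    window : Fin (suc M) → Fin n → Bool
    window i k = c (u₀ ↓[ ε ] (toℕ i ℕ.+ toℕ k))
    code : Fin (suc M) → Fin M
    code i = encode n (window i)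
    from : (Σ (Fin (suc M)) λ i → Σ (Fin (suc M)) λ j → toℕ i ℕ.< toℕ j × code i ≡ code j) →
           c (u ↓[ ε ] (M !)) ≡ c u
    from (i , j , i<j , eq) = conclude
      (m∣n! (ℕP.m<n⇒0<n∸m i<j) (ℕP.≤-trans (ℕP.m∸n≤m (toℕ j) (toℕ i)) (ℕP.≤-pred (FinP.toℕ<n j))))
      where
      h : ℕ
      h = toℕ j ℕ.∸ toℕ i
      i+h : toℕ i ℕ.+ h ≡ toℕ j
      i+h = ℕP.m+[n∸m]≡n (ℕP.<⇒≤ i<j)
      at : ∀ k → (u₀ ↓[ ε ] toℕ i) ↓[ ε ] k ≡ u₀ ↓[ ε ] (toℕ i ℕ.+ k)
      at = ↓-+ u₀ ε (toℕ i)
      start : ∀ k → k ℕ.< length ξs →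
        c ((u₀ ↓[ ε ] toℕ i) ↓[ ε ] (h ℕ.+ k)) ≡ c ((u₀ ↓[ ε ] toℕ i) ↓[ ε ] k)
      start k k< = ≡.trans (≡.cong c (≡.trans (at (h ℕ.+ k))
        (≡.cong (λ m → u₀ ↓[ ε ] m) (≡.trans (≡.sym (ℕP.+-assoc (toℕ i) h k)) (≡.cong (ℕ._+ k) i+h)))))
        (≡.trans (≡.sym (≡.subst (λ m → c (u₀ ↓[ ε ] (toℕ i ℕ.+ m)) ≡ c (u₀ ↓[ ε ] (toℕ j ℕ.+ m)))
          (FinP.toℕ-fromℕ< k<n)
                    (encode-injective n (window i) (window j) eq (fromℕ< k<n))))
                 (≡.cong c (≡.sym (at k))))
        where
        k<n : k ℕ.< n
        k<n = ℕP.<-≤-trans k< len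
      forward : ∀ k → c ((u₀ ↓[ ε ] toℕ i) ↓[ ε ] (h ℕ.+ k)) ≡ c ((u₀ ↓[ ε ] toℕ i) ↓[ ε ] k)
      forward = windows-determine ε ξs c kc (u₀ ↓[ ε ] toℕ i) h start
      iterate : ∀ q k → c ((u₀ ↓[ ε ] toℕ i) ↓[ ε ] (q ℕ.* h ℕ.+ k)) ≡ c ((u₀ ↓[ ε ] toℕ i) ↓[ ε ] k)
      iterate zero k = ≡.refl
      iterate (suc q) k = ≡.trans (≡.cong (λ m → c ((u₀ ↓[ ε ] toℕ i) ↓[ ε ] m)) (ℕP.+-assoc h (q ℕ.* h) k))
        (≡.trans (forward (q ℕ.* h ℕ.+ k)) (iterate q k))
      r : ℕ
      r = M ℕ.∸ toℕ i
      i+r : toℕ i ℕ.+ r ≡ M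
      i+r = ℕP.m+[n∸m]≡n (ℕP.≤-pred (FinP.toℕ<n i))
      base : (u₀ ↓[ ε ] toℕ i) ↓[ ε ] r ≡ u
      base = ≡.trans (at r) (≡.trans (≡.cong (λ m → u₀ ↓[ ε ] m) i+r) (+²-cancel u (+ M *² ε)))
      conclude : h ℕD.∣ M ! → c (u ↓[ ε ] (M !)) ≡ c u
      conclude (ℕD.divides q eqM) = ≡.trans (≡.cong c (≡.trans (≡.cong (λ w → w ↓[ ε ] (M !)) (≡.sym base))
          (≡.trans (↓-+ (u₀ ↓[ ε ] toℕ i) ε r (M !)) (≡.cong (λ m → (u₀ ↓[ ε ] toℕ i) ↓[ ε ] m)
            (≡.trans (ℕP.+-comm r (M !)) (≡.cong (ℕ._+ r) eqM))))))
        (≡.trans (iterate q r) (≡.cong c base))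

  abstract
    coverings-periodic : ∀ D b a → ¬ L.HasLinePolyFactor (L.gPoly D b a) → ∀ ε →
      Σ ℕ λ n → ∀ c → IsCovering D b a c → Shift (+ suc n *² ε) c
    -- Equality of two Booleans is stable under double negation, so the classically obtained roots
    -- suffice here. The period is stated through its predecessor, which keeps it positive.
    coverings-periodic D b a noFactor ε = ℕ.pred (M !) , λ c cov u → decidable-stable (c _ BoolP.≟ c u) λ ne →
      proj₂ (covering-annihilator ε D b a noFactor) c cov λ (ξs , len , k) →
        ne (≡.subst (λ m → c (u -² (+ m *² ε)) ≡ c u) (≡.sym (ℕP.suc-pred (M !) {{M ℕP.!≢0}}))
              (annihilated⇒periodic ε ξs n len c k u))
      where
      n M : ℕ
      n = proj₁ (covering-annihilator ε D b a noFactor)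
      M = 2 ℕ.^ n

-- Residues and the finite search over blocks

%ℕ-shift : ∀ x k n → (x ℤ.+ k ℤ.* + suc n) %ℕ suc n ≡ x %ℕ suc n
%ℕ-shift x k n = remainder-unique ((q′ ℤ.+ k) ℤ.- q) (n%ℕd<d x′ N) (n%ℕd<d x N)
  (arith (+ (x′ %ℕ N)) q (+ (x %ℕ N)) q′ (+ N) (≡.trans (≡.sym (a≡a%ℕn+[a/ℕn]*n x′ N))
    (≡.cong (λ y → y ℤ.+ k ℤ.* + N) (a≡a%ℕn+[a/ℕn]*n x N))))
  where
  N : ℕ
  N = suc n
  x′ q q′ : ℤ
  x′ = x ℤ.+ k ℤ.* + N
  q = x′ /ℕ N
  q′ = x /ℕ N
  arith : ∀ r q r′ q′ N → r ℤ.+ q ℤ.* N ≡ (r′ ℤ.+ q′ ℤ.* N) ℤ.+ k ℤ.* N → r ℤ.- r′ ≡ ((q′ ℤ.+ k) ℤ.- q) ℤ.* N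
  arith r q r′ q′ N eq = ≡.trans (Z.solve 4
    (λ r q r′ N → r Z.:- r′ Z.:= (r Z.:+ q Z.:* N) Z.:- (r′ Z.:+ q Z.:* N)) ≡.refl r q r′ N)
    (≡.trans (≡.cong (λ y → y ℤ.- (r′ ℤ.+ q ℤ.* N)) eq)
      (Z.solve 5 (λ r′ q q′ k N → ((r′ Z.:+ q′ Z.:* N) Z.:+ k Z.:* N) Z.:- (r′ Z.:+ q Z.:* N) Z.:=
        ((q′ Z.:+ k) Z.:- q) Z.:* N) ≡.refl r′ q q′ k N))
  remainder-unique : ∀ {r r′} q → r ℕ.< suc n → r′ ℕ.< suc n → + r ℤ.- + r′ ≡ q ℤ.* + suc n → r ≡ r′
  remainder-unique {r} {r′} q r< r′< eq = ℤP.+-injective (ℤP.i-j≡0⇒i≡j (+ r) (+ r′) (ℤP.∣i∣≡0⇒i≡0 (small dvd bound)))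
    where
    dvd : suc n ℕD.∣ ∣ + r ℤ.- + r′ ∣
    dvd = ℕD.divides ∣ q ∣ (≡.trans (≡.cong ∣_∣ eq) (ℤP.abs-* q (+ suc n)))
    bound : ∣ + r ℤ.- + r′ ∣ ℕ.< suc n
    bound = ≡.subst (λ z → ∣ z ∣ ℕ.< suc n) (≡.sym (ℤP.m-n≡m⊖n r r′))
      (ℕP.≤-<-trans (ℤP.∣m⊝n∣≤m⊔n r r′) (ℕP.⊔-lub r< r′<))
    small : ∀ {m} → suc n ℕD.∣ m → m ℕ.< suc n → m ≡ 0
    small {zero}  _ _  = ≡.refl
    small {suc m} d m< = ⊥-elim (ℕP.<⇒≱ m< (ℕD.∣⇒≤ d))

count-cong : ∀ {c c′ : Config} → (∀ u → c u ≡ c′ u) → ∀ D u → count c D u ≡ count c′ D u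
count-cong eq [] u = ≡.refl
count-cong eq (v ∷ D) u = ≡.cong₂ (λ t n → (if t then 1 else 0) ℕ.+ n) (eq (u +² v)) (count-cong eq D u)

count-cong-at : ∀ {c : Config} {u u′} → (∀ v → c (u +² v) ≡ c (u′ +² v)) → ∀ D → count c D u ≡ count c D u′
count-cong-at eq [] = ≡.refl
count-cong-at eq (v ∷ D) = ≡.cong₂ (λ t n → (if t then 1 else 0) ℕ.+ n) (eq v) (count-cong-at eq D)

covering-cong : ∀ {c c′ : Config} → (∀ u → c u ≡ c′ u) → ∀ D b a → IsCovering D b a c → IsCovering D b a c′
covering-cong eq D b a cov u =
  ≡.trans (≡.sym (count-cong eq D u)) (≡.trans (cov u) (≡.cong (λ t → if t then b else a) (eq u)))

residue : ∀ n → ℤ → Fin (suc n)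
residue n x = fromℕ< (n%ℕd<d x (suc n))

representative : ∀ n → ℤ² → ℤ²
representative n (x , y) = + toℕ (residue n x) , + toℕ (residue n y)

toℕ-residue : ∀ n x → + toℕ (residue n x) ≡ + (x %ℕ suc n)
toℕ-residue n x = ≡.cong +_ (FinP.toℕ-fromℕ< (n%ℕd<d x (suc n)))

residue-split : ∀ n x → x ≡ + toℕ (residue n x) ℤ.+ (x /ℕ suc n) ℤ.* + suc n
residue-split n x = ≡.trans (a≡a%ℕn+[a/ℕn]*n x (suc n))
  (≡.cong (λ r → r ℤ.+ (x /ℕ suc n) ℤ.* + suc n) (≡.sym (toℕ-residue n x)))

residue-shift : ∀ n x k → residue n (x ℤ.+ k ℤ.* + suc n) ≡ residue n x
residue-shift n x k = FinP.fromℕ<-cong _ _ (%ℕ-shift x k n) (n%ℕd<d (x ℤ.+ k ℤ.* + suc n) (suc n)) (n%ℕd<d x (suc n))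

residue-+ : ∀ n x v → residue n (x ℤ.+ v) ≡ residue n (+ toℕ (residue n x) ℤ.+ v)
residue-+ n x v = ≡.trans (≡.cong (residue n) (≡.trans (≡.cong (λ y → y ℤ.+ v) (residue-split n x))
    (Z.solve 3 (λ r v m → (r Z.:+ m) Z.:+ v Z.:= (r Z.:+ v) Z.:+ m) ≡.refl (+ toℕ (residue n x)) v
      ((x /ℕ suc n) ℤ.* + suc n))))
  (residue-shift n (+ toℕ (residue n x) ℤ.+ v) (x /ℕ suc n))

decode-representative : ∀ n blk u v → decode (n , blk) (u +² v) ≡ decode (n , blk) (representative n u +² v)
decode-representative n blk (x , y) (v , w) = ≡.cong₂ blk (residue-+ n x v) (residue-+ n y w)

-- Both sides of the covering condition depend on u only through its residues, so testing one block
-- of positions decides it on all of ℤ².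
covering? : ∀ D b a (e : PeriodicDesc) → Dec (IsCovering D b a (decode e))
covering? D b a (n , blk) = map′ extend (λ cov i j → cov (+ toℕ i , + toℕ j))
  (FinP.all? λ i → FinP.all? λ j → count d D (+ toℕ i , + toℕ j) ℕ.≟ (if d (+ toℕ i , + toℕ j) then b else a))
  where
  d : Config
  d = decode (n , blk)
  extend : (∀ i j → count d D (+ toℕ {suc n} i , + toℕ {suc n} j) ≡ (if d (+ toℕ i , + toℕ j) then b else a)) →
           IsCovering D b a d
  extend h u@(x , y) = ≡.trans (count-cong-at (decode-representative n blk u) D)
    (≡.trans (h (residue n x) (residue n y)) (≡.cong (λ t → if t then b else a) (≡.sym same)))
    where
    same : d u ≡ d (representative n u)
    same = ≡.trans (≡.cong d (≡.sym (+²-identityʳ u)))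
      (≡.trans (decode-representative n blk u 0²) (≡.cong d (+²-identityʳ (representative n u))))
      where
      +²-identityʳ : ∀ u → u +² 0² ≡ u
      +²-identityʳ (x , y) = ≡.cong₂ _,_ (ℤP.+-identityʳ x) (ℤP.+-identityʳ y)

blockOf : ∀ n → Fin (2 ℕ.^ (suc n ℕ.* suc n)) → PeriodicDesc
blockOf n k = n , λ i j → decodeFin (suc n ℕ.* suc n) k (combine i j)

blockEntries : ∀ n → Config → Fin (suc n ℕ.* suc n) → Bool
blockEntries n c t = c (+ toℕ (proj₁ (remQuot {suc n} (suc n) t)) , + toℕ (proj₂ (remQuot {suc n} (suc n) t)))

blockCode : ∀ n → Config → Fin (2 ℕ.^ (suc n ℕ.* suc n))
blockCode n c = encode (suc n ℕ.* suc n) (blockEntries n c)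

decode-blockCode : ∀ n c u → decode (blockOf n (blockCode n c)) u ≡ c (representative n u)
decode-blockCode n c (x , y) = ≡.trans
  (decodeFin-encode (suc n ℕ.* suc n) (blockEntries n c) (combine (residue n x) (residue n y)))
  (≡.cong (λ p → c (+ toℕ (proj₁ p) , + toℕ (proj₂ p))) (FinP.remQuot-combine (residue n x) (residue n y)))

Shift-multiple : ∀ w c → Shift w c → ∀ k → Shift (k *² w) c
Shift-multiple w c sh (+ n) = natural n
  where
  natural : ∀ n → Shift (+ n *² w) c
  natural zero u = ≡.cong c (↓-0 u w)
  natural (suc n) u = ≡.trans (≡.cong c (≡.sym (↓-1 u w n))) (≡.trans (sh (u ↓[ w ] n)) (natural n u))
Shift-multiple w c sh -[1+ n ] u = ≡.trans (≡.sym (Shift-multiple w c sh (+ suc n) (u -² (-[1+ n ] *² w))))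
  (≡.cong c back)
  where
  back : (u -² (-[1+ n ] *² w)) -² (+ suc n *² w) ≡ u
  back = ≡.trans (≡.cong (λ z → z -² (+ suc n *² w))
    (≡.trans (≡.cong (λ z → u -² z) (neg-*² (+ suc n) w)) (-²-neg u (+ suc n *² w))))
                 (+²-cancel u (+ suc n *² w))

e₁ e₂ : ℤ²
e₁ = + 1 , + 0
e₂ = + 0 , + 1

doubly-periodic⇒representative : ∀ n c → Shift (+ suc n *² e₁) c → Shift (+ suc n *² e₂) c →
  ∀ u → c (representative n u) ≡ c u
doubly-periodic⇒representative n c sh₁ sh₂ u@(x , y) = ≡.trans (≡.cong c place)
  (≡.trans (Shift-multiple _ c sh₂ (y /ℕ suc n) _) (Shift-multiple _ c sh₁ (x /ℕ suc n) u))
  where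
  shift-x : ∀ x r q q′ N → x ≡ r ℤ.+ q ℤ.* N → r ≡ (x ℤ.- q ℤ.* (N ℤ.* + 1)) ℤ.- q′ ℤ.* (N ℤ.* + 0)
  shift-x _ r q q′ N ≡.refl = Z.solve 4
    (λ r q q′ N → r Z.:= ((r Z.:+ q Z.:* N) Z.:- q Z.:* (N Z.:* Z.con (+ 1))) Z.:- q′ Z.:* (N Z.:* Z.con (+ 0)))
      ≡.refl r q q′ N
  shift-y : ∀ y r q q′ N → y ≡ r ℤ.+ q ℤ.* N → r ≡ (y ℤ.- q′ ℤ.* (N ℤ.* + 0)) ℤ.- q ℤ.* (N ℤ.* + 1)
  shift-y _ r q q′ N ≡.refl = Z.solve 4
    (λ r q q′ N → r Z.:= ((r Z.:+ q Z.:* N) Z.:- q′ Z.:* (N Z.:* Z.con (+ 0))) Z.:- q Z.:* (N Z.:* Z.con (+ 1)))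
      ≡.refl r q q′ N
  place : representative n u ≡ (u -² ((x /ℕ suc n) *² (+ suc n *² e₁))) -² ((y /ℕ suc n) *² (+ suc n *² e₂))
  place = ≡.cong₂ _,_ (shift-x x _ (x /ℕ suc n) (y /ℕ suc n) (+ suc n) (residue-split n x))
                      (shift-y y _ (y /ℕ suc n) (x /ℕ suc n) (+ suc n) (residue-split n y))

periodic⇒effectivelyFinite : ∀ D b a n →
  (∀ c → IsCovering D b a c → Shift (+ suc n *² e₁) c × Shift (+ suc n *² e₂) c) → EffectivelyFinite D b a
periodic⇒effectivelyFinite D b a n periodic = filter covers? candidates , all-filter covers? candidates , complete
  where
  covers? = covering? D b a
  candidates : List PeriodicDesc
  candidates = map (blockOf n) (allFin (2 ℕ.^ (suc n ℕ.* suc n)))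
  complete : ∀ c → IsCovering D b a c → Any (λ e → ∀ u → c u ≡ decode e u) (filter covers? candidates)
  complete c cov = lose (∈-filter⁺ covers? (∈-map⁺ (blockOf n) (∈-allFin (blockCode n c)))
    -- The block cut out of c passes the filter because its decoding agrees with c everywhere and is
    -- therefore a covering as well.
    (covering-cong agree D b a cov)) agree
    where
    agree : ∀ u → c u ≡ decode (blockOf n (blockCode n c)) u
    agree u = ≡.sym (≡.trans (decode-blockCode n c u)
      (doubly-periodic⇒representative n c (proj₁ (periodic c cov)) (proj₂ (periodic c cov)) u))

theorem27 : ∀ {c ℓ : Level} (K : ACField0 c ℓ) (D : List ℤ²) (b a : ℕ) →
    Unique D →
    ¬ Laurent.HasLinePolyFactor K (Laurent.gPoly K D b a) →
    EffectivelyFinite D b a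
-- `n₂ + n₁ * suc n₂` is the predecessor of `suc n₁ * suc n₂`, a common multiple of the horizontal
-- and the vertical period; a square block needs the same period in both directions.
theorem27 K D b a _ noFactor = periodic⇒effectivelyFinite D b a (n₂ ℕ.+ n₁ ℕ.* suc n₂) λ c cov →
  ≡.subst (λ w → Shift w c) (multiple (suc n₂) (suc n₁) (ℕP.*-comm (suc n₂) (suc n₁)) e₁)
    (Shift-multiple (+ suc n₁ *² e₁) c (proj₂ period₁ c cov) (+ suc n₂)) ,
  ≡.subst (λ w → Shift w c) (multiple (suc n₁) (suc n₂) ≡.refl e₂)
    (Shift-multiple (+ suc n₂ *² e₂) c (proj₂ period₂ c cov) (+ suc n₁))
  where
  period₁ : Σ ℕ λ n → ∀ c → IsCovering D b a c → Shift (+ suc n *² e₁) c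
  period₁ = coverings-periodic K D b a noFactor e₁
  period₂ : Σ ℕ λ n → ∀ c → IsCovering D b a c → Shift (+ suc n *² e₂) c
  period₂ = coverings-periodic K D b a noFactor e₂
  n₁ n₂ : ℕ
  n₁ = proj₁ period₁
  n₂ = proj₁ period₂
  multiple : ∀ i j {m} → i ℕ.* j ≡ m → ∀ v → + i *² (+ j *² v) ≡ + m *² v
  multiple i j eq v = ≡.trans (*²-assoc (+ i) (+ j) v)
    (≡.cong (_*² v) (≡.trans (≡.sym (ℤP.pos-* i j)) (≡.cong +_ eq)))
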